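{- There exists an algorithm which, given as input an integral matrix $A\in\mathbb{Z}^{d\times n}$ whose cone $\operatorname{cone}(A)$ is pointed, computes a finite explicit representation of the set $H$ of holes of the semigroup $Q$ generated by the columns of $A$. That is, the algorithm computes a finite index set $I$, vectors $h_i\in\mathbb{Z}^d$ ($i\in I$), and monoids $M_i\subseteq\mathbb{Z}^d$ ($i\in I$), each $M_i$ given by a finite set of generators in $\mathbb{Z}^d$, such that \[ H=\bigcup_{i\in I}\left(\{h_i\}+M_i\right). \]
   Context: Let $A\in\mathbb{Z}^{d\times n}$ have columns $A_{.1},\dots,A_{.n}$, and let $\mathbb{Z}_+$ denote the nonnegative integers. The semigroup generated by the columns is $Q=\{A\lambda:\lambda\in\mathbb{Z}_+^n\}$ (it contains $0$). Let $\operatorname{cone}(A)=\{A\lambda:\lambda\in\mathbb{R}^n,\ \lambda\ge 0\}$ and $\operatorname{lattice}(A)=\{A\lambda:\lambda\in\mathbb{Z}^n\}$. The saturation of $Q$ is $Q_{\mathrm{sat}}=\operatorname{cone}(A)\cap\operatorname{lattice}(A)$. Standing assumption: $\operatorname{cone}(A)$ is pointed (contains no line). The set of holes of $Q$ is $H=Q_{\mathrm{sat}}\setminus Q$; it may be empty, finite or infinite. A monoid $M_i$ is a subset of $\mathbb{Z}^d$ of the form of all nonnegative integer combinations of finitely many generators; it may be trivial, $M_i=\{0\}$. The union need not be disjoint. -}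

module Defs where

open import Algebra.Bundles.Raw using (RawSemiring)
import Algebra.Definitions.RawMonoid as RawSum
open import Data.Fin.Base using (Fin)
open import Data.Integer.Base as ℤ using (ℤ; +_)
open import Data.Nat.Base as ℕ using (ℕ; _⊔_)
import Data.Nat.Properties as ℕ
open import Data.Product.Base using (Σ-syntax; ∃-syntax; _×_; _,_)
open import Data.Rational.Base as ℚ using (ℚ; 0ℚ; 1ℚ; ½; ∣_∣)
import Data.Rational.Properties as ℚ
open import Data.Rational.Solver using (module +-*-Solver)
open import Data.Vec.Functional using (Vector; map; zipWith; replicate)
open import Data.Vec.Functional.Relation.Binary.Pointwise using (Pointwise)
open import Level using (0ℓ)
open import Relation.Binary.PropositionalEquality
  using (_≡_; refl; sym; cong; subst; module ≡-Reasoning)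
open import Relation.Nullary using (¬_)
open import Relation.Unary using (Pred; _∈_; _⊆_; _∩_; _∖_; _⊢_; ⋃)

-- A real number is a Cauchy sequence of rationals; _≃_ identifies two
-- sequences when their difference tends to 0, and x ≤ᴿ y says that x
-- eventually stays below y + ε for every positive ε.

OscillatesBelow : (ℕ → ℚ) → ℚ → ℕ → Set
OscillatesBelow s ε N = ∀ m n → N ℕ.≤ m → N ℕ.≤ n → ∣ s m ℚ.- s n ∣ ℚ.< ε

Cauchy : (ℕ → ℚ) → Set
Cauchy s = ∀ ε → 0ℚ ℚ.< ε → ∃[ N ] OscillatesBelow s ε N

Bounded : (ℕ → ℚ) → Set
Bounded s = ∃[ B ] (0ℚ ℚ.< B × ∃[ N ] (∀ n → N ℕ.≤ n → ∣ s n ∣ ℚ.≤ B))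

record ℝ : Set where
  constructor mkℝ
  field
    seq    : ℕ → ℚ
    cauchy : Cauchy seq

open ℝ public

infix 4 _≃_ _≤ᴿ_

_≃_ : ℝ → ℝ → Set
x ≃ y = ∀ ε → 0ℚ ℚ.< ε →
  ∃[ N ] (∀ n → N ℕ.≤ n → ∣ seq x n ℚ.- seq y n ∣ ℚ.< ε)

_≤ᴿ_ : ℝ → ℝ → Set
x ≤ᴿ y = ∀ ε → 0ℚ ℚ.< ε →
  ∃[ N ] (∀ n → N ℕ.≤ n → seq x n ℚ.< seq y n ℚ.+ ε)

-- Abstract so that these proofs are never unfolded when comparing reals.
abstract
  const-cauchy : ∀ q → Cauchy (λ _ → q)
  const-cauchy q ε 0<ε =
    0 , λ _ _ _ _ → subst (ℚ._< ε) (sym (cong ∣_∣ (ℚ.+-inverseʳ q))) 0<ε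

  +-cauchy : ∀ s t → Cauchy s → Cauchy t → Cauchy (λ n → s n ℚ.+ t n)
  +-cauchy s t cs ct ε 0<ε =
    let (M , p) = cs (½ ℚ.* ε) 0<ε/2
        (N , q) = ct (½ ℚ.* ε) 0<ε/2
    in M ⊔ N , λ m n M⊔N≤m M⊔N≤n → begin-strict
      ∣ (s m ℚ.+ t m) ℚ.- (s n ℚ.+ t n) ∣
        ≡⟨ cong ∣_∣ (rearrange (s m) (t m) (s n) (t n)) ⟩
      ∣ (s m ℚ.- s n) ℚ.+ (t m ℚ.- t n) ∣
        ≤⟨ ℚ.∣p+q∣≤∣p∣+∣q∣ (s m ℚ.- s n) (t m ℚ.- t n) ⟩
      ∣ s m ℚ.- s n ∣ ℚ.+ ∣ t m ℚ.- t n ∣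
        <⟨ ℚ.+-mono-<
             (p m n (ℕ.m⊔n≤o⇒m≤o M N M⊔N≤m) (ℕ.m⊔n≤o⇒m≤o M N M⊔N≤n))
             (q m n (ℕ.m⊔n≤o⇒n≤o M N M⊔N≤m) (ℕ.m⊔n≤o⇒n≤o M N M⊔N≤n)) ⟩
      ½ ℚ.* ε ℚ.+ ½ ℚ.* ε
        ≡⟨ sym (ℚ.*-distribʳ-+ ε ½ ½) ⟩
      1ℚ ℚ.* ε
        ≡⟨ ℚ.*-identityˡ ε ⟩
      ε ∎
    where
    open ℚ.≤-Reasoning
    0<ε/2 : 0ℚ ℚ.< ½ ℚ.* ε
    0<ε/2 = ℚ.*-monoʳ-<-pos ½ 0<ε
    rearrange : ∀ a b c d →
      (a ℚ.+ b) ℚ.- (c ℚ.+ d) ≡ (a ℚ.- c) ℚ.+ (b ℚ.- d)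
    rearrange = solve 4
      (λ a b c d → (a :+ b) :- (c :+ d) := (a :- c) :+ (b :- d)) refl
      where open +-*-Solver

  cauchy⇒bounded : ∀ s → Cauchy s → Bounded s
  cauchy⇒bounded s cs =
    let (N , p) = cs 1ℚ (ℚ.positive⁻¹ 1ℚ)
        B = ∣ s N ∣ ℚ.+ 1ℚ
    in B
     , ℚ.+-mono-≤-< (ℚ.0≤∣p∣ (s N)) (ℚ.positive⁻¹ 1ℚ)
     , N
     , λ n N≤n → begin
         ∣ s n ∣
           ≡⟨ cong ∣_∣ (split (s n) (s N)) ⟩
         ∣ s N ℚ.+ (s n ℚ.- s N) ∣
           ≤⟨ ℚ.∣p+q∣≤∣p∣+∣q∣ (s N) (s n ℚ.- s N) ⟩
         ∣ s N ∣ ℚ.+ ∣ s n ℚ.- s N ∣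
           ≤⟨ ℚ.+-monoʳ-≤ ∣ s N ∣ (ℚ.<⇒≤ (p n N N≤n ℕ.≤-refl)) ⟩
         B ∎
    where
    open ℚ.≤-Reasoning
    split : ∀ a b → a ≡ b ℚ.+ (a ℚ.- b)
    split = solve 2 (λ a b → a := b :+ (a :- b)) refl
      where open +-*-Solver

  divide : ∀ b ε → 0ℚ ℚ.< b → 0ℚ ℚ.< ε → ∃[ δ ] (0ℚ ℚ.< δ × b ℚ.* δ ≡ ε)
  divide b ε 0<b 0<ε = b⁻¹ ℚ.* ε , 0<δ , (begin
    b ℚ.* (b⁻¹ ℚ.* ε)  ≡⟨ sym (ℚ.*-assoc b b⁻¹ ε) ⟩
    b ℚ.* b⁻¹ ℚ.* ε    ≡⟨ cong (ℚ._* ε) (ℚ.*-inverseʳ b) ⟩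
    1ℚ ℚ.* ε           ≡⟨ ℚ.*-identityˡ ε ⟩
    ε                  ∎)
    where
    open ≡-Reasoning
    instance
      b-pos : ℚ.Positive b
      b-pos = ℚ.positive 0<b
      b-nonZero : ℚ.NonZero b
      b-nonZero = ℚ.pos⇒nonZero b
    b⁻¹ : ℚ
    b⁻¹ = ℚ.1/ b
    0<δ : 0ℚ ℚ.< b⁻¹ ℚ.* ε
    0<δ = subst (ℚ._< b⁻¹ ℚ.* ε) (ℚ.*-zeroʳ b⁻¹)
      (ℚ.*-monoʳ-<-pos b⁻¹ {{ℚ.1/pos⇒pos b}} 0<ε)

  *-close : ∀ {B C δ} a b c d → 0ℚ ℚ.< B → 0ℚ ℚ.< C →
    ∣ a ∣ ℚ.≤ B → ∣ d ∣ ℚ.≤ C → ∣ a ℚ.- c ∣ ℚ.< δ → ∣ b ℚ.- d ∣ ℚ.< δ →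
    ∣ a ℚ.* b ℚ.- c ℚ.* d ∣ ℚ.< (B ℚ.+ C) ℚ.* δ
  *-close {B} {C} {δ} a b c d 0<B 0<C a≤B d≤C a-c<δ b-d<δ = begin-strict
    ∣ a ℚ.* b ℚ.- c ℚ.* d ∣
      ≡⟨ cong ∣_∣ (rearrange a b c d) ⟩
    ∣ a ℚ.* (b ℚ.- d) ℚ.+ d ℚ.* (a ℚ.- c) ∣
      ≤⟨ ℚ.∣p+q∣≤∣p∣+∣q∣ (a ℚ.* (b ℚ.- d)) (d ℚ.* (a ℚ.- c)) ⟩
    ∣ a ℚ.* (b ℚ.- d) ∣ ℚ.+ ∣ d ℚ.* (a ℚ.- c) ∣
      <⟨ ℚ.+-mono-< (term B a (b ℚ.- d) 0<B a≤B b-d<δ)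
                    (term C d (a ℚ.- c) 0<C d≤C a-c<δ) ⟩
    B ℚ.* δ ℚ.+ C ℚ.* δ
      ≡⟨ sym (ℚ.*-distribʳ-+ δ B C) ⟩
    (B ℚ.+ C) ℚ.* δ ∎
    where
    open ℚ.≤-Reasoning
    term : ∀ b p q → 0ℚ ℚ.< b → ∣ p ∣ ℚ.≤ b → ∣ q ∣ ℚ.< δ →
           ∣ p ℚ.* q ∣ ℚ.< b ℚ.* δ
    term b p q 0<b p≤b q<δ = subst (ℚ._< b ℚ.* δ) (sym (ℚ.∣p*q∣≡∣p∣*∣q∣ p q))
      (ℚ.≤-<-trans
        (ℚ.*-monoʳ-≤-nonNeg ∣ q ∣ {{ℚ.∣-∣-nonNeg q}} p≤b)
        (ℚ.*-monoʳ-<-pos b {{ℚ.positive 0<b}} q<δ))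
    rearrange : ∀ a b c d →
      a ℚ.* b ℚ.- c ℚ.* d ≡ a ℚ.* (b ℚ.- d) ℚ.+ d ℚ.* (a ℚ.- c)
    rearrange = solve 4
      (λ a b c d → a :* b :- c :* d := a :* (b :- d) :+ d :* (a :- c)) refl
      where open +-*-Solver

  *-cauchy : ∀ s t → Cauchy s → Cauchy t → Cauchy (λ n → s n ℚ.* t n)
  *-cauchy s t cs ct ε 0<ε = step₁ (cauchy⇒bounded s cs) (cauchy⇒bounded t ct)
    where
    st : ℕ → ℚ
    st n = s n ℚ.* t n
    step₁ : Bounded s → Bounded t → ∃[ N ] OscillatesBelow st ε N
    step₁ (B , 0<B , M , s≤B) (C , 0<C , N , t≤C) =
      step₂ (divide (B ℚ.+ C) ε (ℚ.+-mono-< 0<B 0<C) 0<ε)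
      where
      step₂ : ∃[ δ ] (0ℚ ℚ.< δ × (B ℚ.+ C) ℚ.* δ ≡ ε) →
              ∃[ N ] OscillatesBelow st ε N
      step₂ (δ , 0<δ , [B+C]δ≡ε) = step₃ (cs δ 0<δ) (ct δ 0<δ)
        where
        step₃ : ∃[ K ] OscillatesBelow s δ K → ∃[ L ] OscillatesBelow t δ L →
                ∃[ N ] OscillatesBelow st ε N
        step₃ (K , s-close) (L , t-close) = (M ⊔ N) ⊔ (K ⊔ L) , λ m n ≤m ≤n →
          subst (∣ st m ℚ.- st n ∣ ℚ.<_) [B+C]δ≡ε
            (*-close (s m) (t m) (s n) (t n) 0<B 0<C
              (s≤B m (ℕ.m⊔n≤o⇒m≤o M N (left ≤m)))
              (t≤C n (ℕ.m⊔n≤o⇒n≤o M N (left ≤n)))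
              (s-close m n (ℕ.m⊔n≤o⇒m≤o K L (right ≤m)) (ℕ.m⊔n≤o⇒m≤o K L (right ≤n)))
              (t-close m n (ℕ.m⊔n≤o⇒n≤o K L (right ≤m)) (ℕ.m⊔n≤o⇒n≤o K L (right ≤n))))
          where
          left : ∀ {k} → (M ⊔ N) ⊔ (K ⊔ L) ℕ.≤ k → M ⊔ N ℕ.≤ k
          left = ℕ.m⊔n≤o⇒m≤o (M ⊔ N) (K ⊔ L)
          right : ∀ {k} → (M ⊔ N) ⊔ (K ⊔ L) ℕ.≤ k → K ⊔ L ℕ.≤ k
          right = ℕ.m⊔n≤o⇒n≤o (M ⊔ N) (K ⊔ L)

infixl 6 _+ᴿ_
infixl 7 _*ᴿ_

fromℚ : ℚ → ℝ
fromℚ q = mkℝ (λ _ → q) (const-cauchy q)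

_+ᴿ_ : ℝ → ℝ → ℝ
x +ᴿ y = mkℝ (λ n → seq x n ℚ.+ seq y n) (+-cauchy (seq x) (seq y) (cauchy x) (cauchy y))

_*ᴿ_ : ℝ → ℝ → ℝ
x *ᴿ y = mkℝ (λ n → seq x n ℚ.* seq y n) (*-cauchy (seq x) (seq y) (cauchy x) (cauchy y))

0ᴿ 1ᴿ : ℝ
0ᴿ = fromℚ 0ℚ
1ᴿ = fromℚ 1ℚ

ℝ-rawSemiring : RawSemiring 0ℓ 0ℓ
ℝ-rawSemiring = record
  { _≈_ = _≃_
  ; _+_ = _+ᴿ_
  ; _*_ = _*ᴿ_
  ; 0#  = 0ᴿ
  ; 1#  = 1ᴿ
  }

fromℤ : ℤ → ℝ
fromℤ z = fromℚ (z ℚ./ 1)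

-- d rows, n columns; the entry in row i and column j is A i j.
Matrix : Set → ℕ → ℕ → Set
Matrix X d n = Vector (Vector X n) d

module LinearAlgebra (R : RawSemiring 0ℓ 0ℓ) where
  open RawSemiring R
  open RawSum +-rawMonoid using (sum)

  infix  4 _≋_
  infixl 6 _⊕_
  infixr 7 _*ᵥ_ _·_

  _≋_ : ∀ {d} → Vector Carrier d → Vector Carrier d → Set
  _≋_ = Pointwise _≈_

  𝟎 : ∀ {d} → Vector Carrier d
  𝟎 = replicate _ 0#

  _⊕_ : ∀ {d} → Vector Carrier d → Vector Carrier d → Vector Carrier d
  _⊕_ = zipWith _+_

  _·_ : ∀ {d} → Carrier → Vector Carrier d → Vector Carrier d
  t · v = map (t *_) v

  _*ᵥ_ : ∀ {d n} → Matrix Carrier d n → Vector Carrier n → Vector Carrier d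
  (A *ᵥ c) i = sum (zipWith _*_ (A i) c)

module Z = LinearAlgebra ℤ.+-*-rawSemiring
module R = LinearAlgebra ℝ-rawSemiring

Cone : ∀ {d n} → Matrix ℤ d n → Pred (Vector ℝ d) 0ℓ
Cone {n = n} A x =
  Σ[ c ∈ Vector ℝ n ] (∀ j → 0ᴿ ≤ᴿ c j) × map (map fromℤ) A R.*ᵥ c R.≋ x

Lattice : ∀ {d n} → Matrix ℤ d n → Pred (Vector ℤ d) 0ℓ
Lattice {n = n} A x = Σ[ c ∈ Vector ℤ n ] A Z.*ᵥ c Z.≋ x

Semigroup : ∀ {d n} → Matrix ℤ d n → Pred (Vector ℤ d) 0ℓ
Semigroup {n = n} A x = Σ[ c ∈ Vector ℕ n ] A Z.*ᵥ map +_ c Z.≋ x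

Saturation : ∀ {d n} → Matrix ℤ d n → Pred (Vector ℤ d) 0ℓ
Saturation A = (map fromℤ ⊢ Cone A) ∩ Lattice A

Holes : ∀ {d n} → Matrix ℤ d n → Pred (Vector ℤ d) 0ℓ
Holes A = Saturation A ∖ Semigroup A

Line : ∀ {d} → Vector ℝ d → Vector ℝ d → Pred (Vector ℝ d) 0ℓ
Line p v x = Σ[ t ∈ ℝ ] p R.⊕ t R.· v R.≋ x

ContainsLine : ∀ {d} → Pred (Vector ℝ d) 0ℓ → Set
ContainsLine C = ∃[ p ] ∃[ v ] (¬ (v R.≋ R.𝟎) × Line p v ⊆ C)

Pointed : ∀ {d n} → Matrix ℤ d n → Set
Pointed A = ¬ ContainsLine (Cone A)

-- The i-th monoid is generated by the columns of gens i; it is {0} when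
-- #gens i is 0.
record Representation (d : ℕ) : Set where
  field
    size  : ℕ
    shift : Fin size → Vector ℤ d
    #gens : Fin size → ℕ
    gens  : (i : Fin size) → Matrix ℤ d (#gens i)

Translate : ∀ {d} → Vector ℤ d → Pred (Vector ℤ d) 0ℓ → Pred (Vector ℤ d) 0ℓ
Translate h M x = ∃[ m ] (m ∈ M × h Z.⊕ m Z.≋ x)

⟦_⟧ : ∀ {d} → Representation d → Pred (Vector ℤ d) 0ℓ
⟦ r ⟧ = ⋃ (Fin size) (λ i → Translate (shift i) (Semigroup (gens i)))
  where open Representation r

-- Every x in the saturation is f + A μ with μ ∈ ℕⁿ and f among the finitely many
-- saturation points of the zonotope { A ρ | 0 ≤ ρ ≤ 1 }.  For fixed f the μ with
-- f + A μ ∈ Q form an upward closed set whose finitely many generators come from the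
-- minimal solutions of f + A μ = A τ over ℕ; truncating μ at a common bound K of
-- their entries does not affect membership, so the complement is the finite union of
-- the cells c + ℕ^{ j | c j = K } over the c ∈ [0, K]ⁿ outside the set.
--
-- Everything is decided by one fact on systems B x = b over ℕ: the solutions are
-- finitely many particular ones plus sums of finitely many homogeneous ones, the
-- latter not depending on b.  It also replaces Farkas' lemma in showing that an
-- integer point of the real cone is in the rational one.
module Submission where

open import Defs
import Algebra.Properties.Semiring.Sum as Sum
open import Algebra.Bundles using (CommutativeRing)
open import Data.Bool.Base using (Bool; true; false; if_then_else_)
open import Data.Fin.Base using (Fin; zero; suc; _↑ˡ_; _↑ʳ_)
import Data.Fin.Properties as Fin
open import Data.Integer.Base as ℤ using (ℤ; +_; +[1+_]; -[1+_]; 0ℤ; ∣_∣)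
import Data.Integer.Properties as ℤ
open import Data.Integer.Tactic.RingSolver using (solve-∀)
open import Data.List.Base as List
  using (List; []; _∷_; upTo; filter; cartesianProductWith; concatMap)
open import Data.List.Extrema.Nat using (max; xs≤max)
open import Data.List.Membership.Propositional using (_∈_; lose; find)
open import Data.List.Membership.Propositional.Properties
import Data.List.Relation.Unary.All as All
open import Data.List.Relation.Unary.Any as Any using (here; index)
import Data.List.Relation.Unary.Any.Properties as Any
open import Data.Nat.Base
  using (ℕ; zero; suc; _+_; _*_; _∸_; _⊔_; _⊓_; _≤_; _<_; z≤n; s≤s; >-nonZero)
import Data.Nat.DivMod as ℕ
open import Data.Nat.Induction using (<-wellFounded)
import Data.Nat.Properties as ℕ
open import Data.Product.Base using (Σ-syntax; ∃-syntax; _×_; _,_; proj₁; proj₂)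
open import Data.Rational.Base as ℚ using (ℚ; 0ℚ; 1ℚ; mkℚ; fromℚᵘ; toℚᵘ)
import Data.Rational.Properties as ℚ
open import Data.Rational.Solver using (module +-*-Solver)
open import Data.Rational.Unnormalised.Base as ℚᵘ using (mkℚᵘ; *≡*; *≤*)
import Data.Rational.Unnormalised.Properties as ℚᵘ
open import Data.Sum.Base using (_⊎_; inj₁; inj₂)
open import Data.Vec.Functional as Vector using (Vector; zipWith; head; tail)
open import Data.Vec.Functional.Properties using (lookup-++ˡ; lookup-++ʳ)
open import Function.Base using (_∘_; case_of_)
open import Induction.WellFounded using (Acc; acc)
open import Relation.Binary.PropositionalEquality
open import Relation.Nullary
  using (¬_; Dec; yes; no; does; contradiction; ¬?; map′; _×-dec_)
open import Relation.Nullary.Decidable using (dec-true; dec-false)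
open import Relation.Unary using (_≐_)

-- Linear Diophantine systems over ℕ

module ∑ℕ = Sum ℕ.+-*-semiring
module ∑ℤ = Sum ℤ.+-*-semiring

dot : ∀ {n} → Vector ℕ n → Vector ℕ n → ℕ
dot p x = ∑ℕ.sum (zipWith _*_ p x)

lin : ∀ {n} → Vector ℤ n → Vector ℕ n → ℤ
lin a x = ∑ℤ.sum (zipWith ℤ._*_ a (Vector.map +_ x))

infixl 6 _⊕_
infixr 7 _•_

_⊕_ : ∀ {n} → Vector ℕ n → Vector ℕ n → Vector ℕ n
_⊕_ = zipWith _+_

_•_ : ∀ {n} → ℕ → Vector ℕ n → Vector ℕ n
k • x = Vector.map (k *_) x

δ : ∀ {n} → Fin n → Vector ℕ n
δ zero    zero    = 1
δ zero    (suc j) = 0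
δ (suc i) zero    = 0
δ (suc i) (suc j) = δ i j

δ-cases : ∀ {n} (i j : Fin n) → (i ≡ j × δ i j ≡ 1) ⊎ δ i j ≡ 0
δ-cases zero    zero    = inj₁ (refl , refl)
δ-cases zero    (suc j) = inj₂ refl
δ-cases (suc i) zero    = inj₂ refl
δ-cases (suc i) (suc j) with δ-cases i j
... | inj₁ (refl , eq) = inj₁ (refl , eq)
... | inj₂ eq          = inj₂ eq

δ-diag : ∀ {n} (i : Fin n) → δ i i ≡ 1
δ-diag zero    = refl
δ-diag (suc i) = δ-diag i

δ≤1 : ∀ {n} (i j : Fin n) → δ i j ≤ 1
δ≤1 i j with δ-cases i j
... | inj₁ (_ , eq) = ℕ.≤-reflexive eq
... | inj₂ eq       = ℕ.≤-trans (ℕ.≤-reflexive eq) z≤n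

lin-cong : ∀ {n} (a : Vector ℤ n) {x y} → x ≗ y → lin a x ≡ lin a y
lin-cong a x≗y = ∑ℤ.sum-cong-≗ λ i → cong (λ t → a i ℤ.* + t) (x≗y i)

lin-0ˡ : ∀ {n} (x : Vector ℕ n) → lin (λ _ → 0ℤ) x ≡ 0ℤ
lin-0ˡ {zero}  x = refl
lin-0ˡ {suc n} x = trans (ℤ.+-identityˡ _) (lin-0ˡ (tail x))

lin-0ʳ : ∀ {n} (a : Vector ℤ n) → lin a (λ _ → 0) ≡ 0ℤ
lin-0ʳ {zero}  a = refl
lin-0ʳ {suc n} a = cong₂ ℤ._+_ (ℤ.*-zeroʳ (head a)) (lin-0ʳ (tail a))

lin-⊕ : ∀ {n} (a : Vector ℤ n) x y → lin a (x ⊕ y) ≡ lin a x ℤ.+ lin a y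
lin-⊕ a x y = trans
  (∑ℤ.sum-cong-≗ λ i → trans (cong (a i ℤ.*_) (ℤ.pos-+ (x i) (y i)))
                              (ℤ.*-distribˡ-+ (a i) (+ x i) (+ y i)))
  (∑ℤ.∑-distrib-+ (λ i → a i ℤ.* + x i) (λ i → a i ℤ.* + y i))

lin-• : ∀ {n} (a : Vector ℤ n) k x → lin a (k • x) ≡ + k ℤ.* lin a x
lin-• a k x = sym (trans (∑ℤ.*-distribˡ-sum (+ k) (λ i → a i ℤ.* + x i))
  (∑ℤ.sum-cong-≗ λ i → trans (swap (+ k) (a i) (+ x i))
                              (cong (a i ℤ.*_) (sym (ℤ.pos-* k (x i))))))
  where
  swap : ∀ k a x → k ℤ.* (a ℤ.* x) ≡ a ℤ.* (k ℤ.* x)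
  swap = solve-∀

lin-δ : ∀ {n} (a : Vector ℤ n) i → lin a (δ i) ≡ a i
lin-δ a zero    = trans (cong₂ ℤ._+_ (ℤ.*-identityʳ (head a)) (lin-0ʳ (tail a)))
                        (ℤ.+-identityʳ _)
lin-δ a (suc i) = trans (cong₂ ℤ._+_ (ℤ.*-zeroʳ (head a)) (lin-δ (tail a) i))
                        (ℤ.+-identityˡ _)

term≤sum : ∀ {n} (f : Vector ℕ n) i → f i ≤ ∑ℕ.sum f
term≤sum f zero    = ℕ.m≤m+n _ _
term≤sum f (suc i) = ℕ.≤-trans (term≤sum (tail f) i) (ℕ.m≤n+m _ _)

-- Coordinates of weight zero contribute nothing, so the bound is asked only on the support of `p`.
dot≤ : ∀ {n} (p x : Vector ℕ n) {M} → (∀ i → 0 < p i → x i ≤ M) → dot p x ≤ ∑ℕ.sum p * M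
dot≤ {zero}  p x     bnd = z≤n
dot≤ {suc n} p x {M} bnd = subst (dot p x ≤_) (sym (ℕ.*-distribʳ-+ M (head p) _))
  (ℕ.+-mono-≤ (hd (head p) (bnd zero)) (dot≤ (tail p) (tail x) (bnd ∘ suc)))
  where
  hd : ∀ q → (0 < q → head x ≤ M) → q * head x ≤ q * M
  hd zero    _ = z≤n
  hd (suc q) h = ℕ.*-monoʳ-≤ (suc q) (h (s≤s z≤n))

pos neg : ℤ → ℕ
pos (+ n)    = n
pos -[1+ n ] = 0
neg (+ n)    = 0
neg -[1+ n ] = suc n

pos≡+neg : ∀ z → + pos z ≡ z ℤ.+ + neg z
pos≡+neg (+ n)    = sym (ℤ.+-identityʳ (+ n))
pos≡+neg -[1+ n ] = sym (ℤ.+-inverseˡ +[1+ n ])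

neg≤∣∣ : ∀ z → neg z ≤ ∣ z ∣
neg≤∣∣ (+ n)    = z≤n
neg≤∣∣ -[1+ n ] = ℕ.≤-refl

pos≤∣∣ : ∀ z → pos z ≤ ∣ z ∣
pos≤∣∣ (+ n)    = ℕ.≤-refl
pos≤∣∣ -[1+ n ] = z≤n

-- Stated additively, so that both signed parts are sums of naturals, to which `term≤sum` and `dot≤`
-- apply.
dot-pos : ∀ {n} (a : Vector ℤ n) x →
  + dot (pos ∘ a) x ≡ lin a x ℤ.+ + dot (neg ∘ a) x
dot-pos {zero}  a x = refl
dot-pos {suc n} a x = begin
  + (pos a₀ * x₀ + P)                       ≡⟨ ℤ.pos-+ (pos a₀ * x₀) P ⟩
  + (pos a₀ * x₀) ℤ.+ + P                   ≡⟨ cong₂ ℤ._+_ (ℤ.pos-* (pos a₀) x₀) (dot-pos (tail a) (tail x)) ⟩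
  + pos a₀ ℤ.* + x₀ ℤ.+ (L ℤ.+ + N)         ≡⟨ cong (λ t → t ℤ.* + x₀ ℤ.+ (L ℤ.+ + N)) (pos≡+neg a₀) ⟩
  (a₀ ℤ.+ + neg a₀) ℤ.* + x₀ ℤ.+ (L ℤ.+ + N) ≡⟨ rearrange a₀ (+ neg a₀) (+ x₀) L (+ N) ⟩
  (a₀ ℤ.* + x₀ ℤ.+ L) ℤ.+ (+ neg a₀ ℤ.* + x₀ ℤ.+ + N)
    ≡⟨ cong (λ t → (a₀ ℤ.* + x₀ ℤ.+ L) ℤ.+ (t ℤ.+ + N)) (sym (ℤ.pos-* (neg a₀) x₀)) ⟩
  (a₀ ℤ.* + x₀ ℤ.+ L) ℤ.+ (+ (neg a₀ * x₀) ℤ.+ + N)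
    ≡⟨ cong (λ t → (a₀ ℤ.* + x₀ ℤ.+ L) ℤ.+ t) (sym (ℤ.pos-+ (neg a₀ * x₀) N)) ⟩
  lin a x ℤ.+ + dot (neg ∘ a) x ∎
  where
  open ≡-Reasoning
  a₀ = head a
  x₀ = head x
  P = dot (pos ∘ tail a) (tail x)
  N = dot (neg ∘ tail a) (tail x)
  L = lin (tail a) (tail x)
  rearrange : ∀ a n x l m →
    (a ℤ.+ n) ℤ.* x ℤ.+ (l ℤ.+ m) ≡ (a ℤ.* x ℤ.+ l) ℤ.+ (n ℤ.* x ℤ.+ m)
  rearrange = solve-∀

-- Finitely generated solution sets

box : ℕ → ∀ n → List (Vector ℕ n)
box K zero    = Vector.[] ∷ []
box K (suc n) = cartesianProductWith Vector._∷_ (upTo (suc K)) (box K n)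

-- Vectors are functions, so in the absence of function extensionality the list is only shown to
-- contain a pointwise equal copy of `x`.
box-complete : ∀ {K n} (x : Vector ℕ n) → (∀ i → x i ≤ K) → ∃[ y ] (y ∈ box K n × x ≗ y)
box-complete {K} {zero}  x x≤K = Vector.[] , here refl , λ ()
box-complete {K} {suc n} x x≤K =
  let (y , y∈ , x≗y) = box-complete (tail x) (x≤K ∘ suc)
  in head x Vector.∷ y
   , ∈-cartesianProductWith⁺ Vector._∷_ (∈-upTo⁺ (s≤s (x≤K zero))) y∈
   , λ { zero → refl ; (suc i) → x≗y i }

-- The semilinear set of all `g` in `G` plus sums of elements of `H`, built one summand at a time
-- and closed under pointwise equality.
data Generated {n} (G H : List (Vector ℕ n)) : Vector ℕ n → Set where
  start : ∀ {x g} → g ∈ G → x ≗ g → Generated G H x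
  step  : ∀ {x h y} → h ∈ H → Generated G H y → x ≗ y ⊕ h → Generated G H x

generated-resp : ∀ {n} {G H : List (Vector ℕ n)} {x y} → x ≗ y → Generated G H y → Generated G H x
generated-resp x≗y (start g∈ y≗g)  = start g∈ λ i → trans (x≗y i) (y≗g i)
generated-resp x≗y (step h∈ z eq) = step h∈ z λ i → trans (x≗y i) (eq i)

Sol : ∀ {d n} → Matrix ℤ d n → Vector ℤ d → Vector ℕ n → Set
Sol B b x = ∀ i → lin (B i) x ≡ b i

-- `periods` is independent of the right-hand side `b`; only `starts` varies with it. The induction
-- on equations and the passage from the real to the rational cone both rest on this uniformity.
record Basis {d n} (B : Matrix ℤ d n) : Set where
  field
    periods     : List (Vector ℕ n)
    periods-sol : ∀ {h} → h ∈ periods → Sol B (λ _ → 0ℤ) h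
    starts      : Vector ℤ d → List (Vector ℕ n)
    starts-sol  : ∀ {b g} → g ∈ starts b → Sol B b g
    generates   : ∀ {b x} → Sol B b x → Generated (starts b) periods x

-- A single equation

module SingleEquation {n} (a : Vector ℤ n) where

  p q : Vector ℕ n
  p = pos ∘ a
  q = neg ∘ a

  M : ℕ
  M = ∑ℕ.sum p + ∑ℕ.sum q

  p≤M : ∀ i → p i ≤ M
  p≤M i = ℕ.≤-trans (term≤sum p i) (ℕ.m≤m+n _ _)

  q≤M : ∀ i → q i ≤ M
  q≤M i = ℕ.≤-trans (term≤sum q i) (ℕ.m≤n+m _ _)

  -- The summand `M` covers the coordinates that are at most `M`; `M * M + ∣ e ∣` covers those on
  -- the opposite side of the equation, which is then at most `M * M + ∣ e ∣`.
  bound : ℤ → ℕ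
  bound e = M * M + ∣ e ∣ + M

  solutions : ℕ → ℤ → List (Vector ℕ n)
  solutions K e = filter (λ x → lin a x ℤ.≟ e) (box K n)

  solutions-complete : ∀ {K e} x → (∀ i → x i ≤ K) → lin a x ≡ e →
    ∃[ y ] (y ∈ solutions K e × x ≗ y)
  solutions-complete {K} {e} x x≤K eq =
    let (y , y∈ , x≗y) = box-complete x x≤K
    in y , ∈-filter⁺ (λ x → lin a x ℤ.≟ e) y∈ (trans (sym (lin-cong a x≗y)) eq) , x≗y

  solutions-sound : ∀ {K e y} → y ∈ solutions K e → lin a y ≡ e
  solutions-sound {K} {e} y∈ = proj₂ (∈-filter⁻ (λ x → lin a x ℤ.≟ e) {xs = box K n} y∈)

  -- Moving all negative terms across gives an identity in ℕ, where either side bounds each term of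
  -- the other.
  balance : ∀ {e x} → lin a x ≡ e → dot p x + neg e ≡ dot q x + pos e
  balance {e} {x} eq = ℤ.+-injective (begin
    + (dot p x + neg e)                         ≡⟨ ℤ.pos-+ (dot p x) (neg e) ⟩
    + dot p x ℤ.+ + neg e                       ≡⟨ cong (λ t → t ℤ.+ + neg e) (dot-pos a x) ⟩
    lin a x ℤ.+ + dot q x ℤ.+ + neg e           ≡⟨ cong (λ t → t ℤ.+ + dot q x ℤ.+ + neg e) eq ⟩
    e ℤ.+ + dot q x ℤ.+ + neg e                 ≡⟨ rearrange e (+ dot q x) (+ neg e) ⟩
    + dot q x ℤ.+ (e ℤ.+ + neg e)               ≡⟨ cong (λ t → + dot q x ℤ.+ t) (sym (pos≡+neg e)) ⟩
    + dot q x ℤ.+ + pos e                       ≡⟨ sym (ℤ.pos-+ (dot q x) (pos e)) ⟩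
    + (dot q x + pos e) ∎)
    where
    open ≡-Reasoning
    rearrange : ∀ e q n → e ℤ.+ q ℤ.+ n ≡ q ℤ.+ (e ℤ.+ n)
    rearrange = solve-∀

  -- A single term of the right side is at most the whole left side. The local `p` and `q` allow the
  -- argument to be used in both directions.
  one-sided-bound : ∀ (p q x : Vector ℕ n) {c c′} → dot p x + c ≡ dot q x + c′ →
    (∀ i → 0 < p i → x i ≤ M) → ∀ j → 0 < q j → x j ≤ ∑ℕ.sum p * M + c
  one-sided-bound p q x {c} {c′} eq bnd j 0<qj = begin
    x j             ≤⟨ ℕ.m≤n*m (x j) (q j) {{>-nonZero 0<qj}} ⟩
    q j * x j       ≤⟨ term≤sum (zipWith _*_ q x) j ⟩
    dot q x         ≤⟨ ℕ.m≤m+n _ c′ ⟩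
    dot q x + c′    ≡⟨ sym eq ⟩
    dot p x + c     ≤⟨ ℕ.+-monoˡ-≤ c (dot≤ p x bnd) ⟩
    ∑ℕ.sum p * M + c ∎
    where open ℕ.≤-Reasoning

  -- A solution with two large coordinates whose coefficients have opposite signs
  -- dominates a homogeneous solution; otherwise the large coordinates all lie on one
  -- side of the equation, which then bounds them.
  Reducible : Vector ℕ n → Set
  Reducible x = ∃[ h ] ((∀ i → h i ≤ suc (M + M)) × lin a h ≡ 0ℤ ×
                        (∀ i → h i ≤ x i) × ∃[ i ] 0 < h i)

  -- The unit vector is a homogeneous solution. Its entry 1 is the reason for the `suc` in
  -- `suc (M + M)`: `M` is 0 when all coefficients vanish.
  reduce-zero : ∀ {x} i → a i ≡ 0ℤ → 0 < x i → Reducible x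
  reduce-zero {x} i ai≡0 0<xi =
    δ i , (λ l → ℕ.≤-trans (δ≤1 i l) (s≤s z≤n)) , trans (lin-δ a i) ai≡0
    , below , i , ℕ.≤-reflexive (sym (δ-diag i))
    where
    below : ∀ l → δ i l ≤ x l
    below l with δ-cases i l
    ... | inj₁ (refl , eq) = ℕ.≤-trans (ℕ.≤-reflexive eq) 0<xi
    ... | inj₂ eq          = ℕ.≤-trans (ℕ.≤-reflexive eq) z≤n

  cancels : ∀ y z → 0 < pos y → 0 < neg z → + neg z ℤ.* y ℤ.+ + pos y ℤ.* z ≡ 0ℤ
  cancels (+ m) -[1+ k ] _ _ = cancel (+ m) +[1+ k ]
    where
    cancel : ∀ m k → k ℤ.* m ℤ.+ m ℤ.* ℤ.- k ≡ 0ℤ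
    cancel = solve-∀

  reduce-pair : ∀ {x} i j → 0 < p i → M < x i → 0 < q j → M < x j → Reducible x
  reduce-pair {x} i j 0<pi M<xi 0<qj M<xj = w , small , w-hom , below , i , 0<wi
    where
    w : Vector ℕ n
    -- Here `p i = a i` and `q j = - a j`, so the contributions `q j * a i` and `p i * a j` cancel.
    w = q j • δ i ⊕ p i • δ j
    scaled : ∀ {k} t l → k ≤ M → k * δ t l ≤ M
    scaled {k} t l k≤M = ℕ.≤-trans (ℕ.*-monoʳ-≤ k (δ≤1 t l))
      (ℕ.≤-trans (ℕ.≤-reflexive (ℕ.*-identityʳ k)) k≤M)
    small : ∀ l → w l ≤ suc (M + M)
    small l = ℕ.m≤n⇒m≤1+n (ℕ.+-mono-≤ (scaled i l (q≤M j)) (scaled j l (p≤M i)))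
    w-hom : lin a w ≡ 0ℤ
    w-hom = begin
      lin a w                                          ≡⟨ lin-⊕ a (q j • δ i) (p i • δ j) ⟩
      lin a (q j • δ i) ℤ.+ lin a (p i • δ j)          ≡⟨ cong₂ ℤ._+_ (lin-• a (q j) (δ i)) (lin-• a (p i) (δ j)) ⟩
      + q j ℤ.* lin a (δ i) ℤ.+ + p i ℤ.* lin a (δ j)  ≡⟨ cong₂ (λ s t → + q j ℤ.* s ℤ.+ + p i ℤ.* t) (lin-δ a i) (lin-δ a j) ⟩
      + q j ℤ.* a i ℤ.+ + p i ℤ.* a j                  ≡⟨ cancels (a i) (a j) 0<pi 0<qj ⟩
      0ℤ ∎
      where open ≡-Reasoning
    exclusive : ∀ z → 0 < pos z → ¬ 0 < neg z
    exclusive (+ _)    _  ()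
    exclusive -[1+ _ ] () _
    0<wi : 0 < w i
    0<wi = ℕ.≤-trans 0<qj (ℕ.≤-trans
      (ℕ.≤-reflexive (sym (trans (cong (q j *_) (δ-diag i)) (ℕ.*-identityʳ (q j)))))
      (ℕ.m≤m+n _ _))
    below : ∀ l → w l ≤ x l
    -- As `a i > 0 > a j`, the indices differ, so each entry of `w` comes from at most one summand
    -- and is at most `M`.
    below l with δ-cases i l | δ-cases j l
    ... | inj₁ (refl , _) | inj₁ (refl , _) = contradiction 0<qj (exclusive (a i) 0<pi)
    ... | inj₁ (refl , _) | inj₂ eq rewrite eq | ℕ.*-zeroʳ (p i) | ℕ.+-identityʳ (q j * δ i i) =
      ℕ.≤-trans (scaled i i (q≤M j)) (ℕ.<⇒≤ M<xi)
    ... | inj₂ eq | inj₁ (refl , _) rewrite eq | ℕ.*-zeroʳ (q j) =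
      ℕ.≤-trans (scaled j j (p≤M i)) (ℕ.<⇒≤ M<xj)
    ... | inj₂ eq | inj₂ eq′ rewrite eq | eq′ | ℕ.*-zeroʳ (q j) | ℕ.*-zeroʳ (p i) = z≤n

  bounded : ∀ (x : Vector ℕ n) e → ¬ (∃[ i ] (a i ≡ 0ℤ × 0 < x i)) →
    (∀ i → 0 < p i → x i ≤ bound e) → (∀ i → 0 < q i → x i ≤ bound e) → ∀ i → x i ≤ bound e
  bounded x e no-zero onp onq i with a i in eq | onp i | onq i
  ... | -[1+ k ] | _ | f = f (s≤s z≤n)
  ... | +[1+ k ] | f | _ = f (s≤s z≤n)
  ... | + 0      | _ | _ = ℕ.≤-trans (ℕ.≮⇒≥ λ 0<xi → no-zero (i , eq , 0<xi)) z≤n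

  below-bound₁ : ∀ e {k} → k ≤ M → k ≤ bound e
  below-bound₁ e k≤M = ℕ.≤-trans k≤M (ℕ.m≤n+m M (M * M + ∣ e ∣))

  below-bound₂ : ∀ e s c → s ≤ M → c ≤ ∣ e ∣ → s * M + c ≤ bound e
  below-bound₂ e s c s≤M c≤e =
    ℕ.≤-trans (ℕ.+-mono-≤ (ℕ.*-monoˡ-≤ M s≤M) c≤e) (ℕ.m≤m+n (M * M + ∣ e ∣) M)

  reduce-or-bounded : ∀ {e} x → lin a x ≡ e → Reducible x ⊎ (∀ i → x i ≤ bound e)
  reduce-or-bounded {e} x eq
    with Fin.any? (λ i → (a i ℤ.≟ 0ℤ) ×-dec (0 ℕ.<? x i))
       | Fin.any? (λ i → (0 ℕ.<? p i) ×-dec (M ℕ.<? x i))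
       | Fin.any? (λ i → (0 ℕ.<? q i) ×-dec (M ℕ.<? x i))
  ... | yes (i , ai≡0 , 0<xi) | _ | _ = inj₁ (reduce-zero {x} i ai≡0 0<xi)
  ... | no _ | yes (i , 0<pi , M<xi) | yes (j , 0<qj , M<xj) =
    inj₁ (reduce-pair {x} i j 0<pi M<xi 0<qj M<xj)
  ... | no no-zero | no no-p | _ = inj₂ (bounded x e no-zero
      (λ i → below-bound₁ e ∘ p-small i)
      (λ j 0<qj → ℕ.≤-trans (one-sided-bound p q x (balance {e} {x} eq) p-small j 0<qj)
                            (below-bound₂ e (∑ℕ.sum p) (neg e) (ℕ.m≤m+n _ _) (neg≤∣∣ e))))
    where
    p-small : ∀ i → 0 < p i → x i ≤ M
    p-small i 0<pi = ℕ.≮⇒≥ λ M<xi → no-p (i , 0<pi , M<xi)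
  ... | no no-zero | yes _ | no no-q = inj₂ (bounded x e no-zero
      (λ j 0<pj → ℕ.≤-trans (one-sided-bound q p x (sym (balance {e} {x} eq)) q-small j 0<pj)
                            (below-bound₂ e (∑ℕ.sum q) (pos e) (ℕ.m≤n+m (∑ℕ.sum q) (∑ℕ.sum p)) (pos≤∣∣ e)))
      (λ i → below-bound₁ e ∘ q-small i))
    where
    q-small : ∀ i → 0 < q i → x i ≤ M
    q-small i 0<qi = ℕ.≮⇒≥ λ M<xi → no-q (i , 0<qi , M<xi)

  -- Subtracting a dominated homogeneous solution keeps the value `e` and, as that solution has a
  -- positive entry, lowers the coordinate sum. When nothing can be subtracted, `x` lies in the box
  -- of starts.
  descend : ∀ {e} x → Acc _<_ (∑ℕ.sum x) → lin a x ≡ e →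
    Generated (solutions (bound e) e) (solutions (suc (M + M)) 0ℤ) x
  descend {e} x (acc rec) eq with reduce-or-bounded {e} x eq
  ... | inj₂ x≤ = let (g , g∈ , x≗g) = solutions-complete x x≤ eq in start g∈ x≗g
  ... | inj₁ (h , h≤ , h-hom , h≤x , i , 0<hi) =
    let (h′ , h′∈ , h≗h′) = solutions-complete h h≤ h-hom
    in step h′∈ (descend y (rec smaller) y-sol)
         λ l → trans (sym (y⊕h≗x l)) (cong (λ t → y l + t) (h≗h′ l))
    where
    y : Vector ℕ n
    y = zipWith _∸_ x h
    y⊕h≗x : y ⊕ h ≗ x
    y⊕h≗x l = ℕ.m∸n+n≡m (h≤x l)
    smaller : ∑ℕ.sum y < ∑ℕ.sum x
    smaller = subst (∑ℕ.sum y <_)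
      (trans (sym (∑ℕ.∑-distrib-+ y h)) (∑ℕ.sum-cong-≗ y⊕h≗x))
      (ℕ.m<m+n (∑ℕ.sum y) (ℕ.≤-trans 0<hi (term≤sum h i)))
    y-sol : lin a y ≡ e
    y-sol = begin
      lin a y                  ≡⟨ sym (ℤ.+-identityʳ _) ⟩
      lin a y ℤ.+ 0ℤ           ≡⟨ cong (λ t → lin a y ℤ.+ t) (sym h-hom) ⟩
      lin a y ℤ.+ lin a h      ≡⟨ sym (lin-⊕ a y h) ⟩
      lin a (y ⊕ h)            ≡⟨ lin-cong a y⊕h≗x ⟩
      lin a x                  ≡⟨ eq ⟩
      e ∎
      where open ≡-Reasoning

  basis : Basis {1} (λ _ → a)
  basis = record
    { periods     = solutions (suc (M + M)) 0ℤ
    ; periods-sol = λ h∈ _ → solutions-sound h∈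
    ; starts      = λ b → solutions (bound (b zero)) (b zero)
    ; starts-sol  = λ { {b} g∈ zero → solutions-sound g∈ }
    ; generates   = λ {b} {x} sol → descend x (<-wellFounded _) (sol zero)
    }

-- From one equation to a system

comb : ∀ {k n} → Matrix ℕ n k → Vector ℕ k → Vector ℕ n
comb V μ i = dot (V i) μ

-- Interchanging the sums makes `a` on `V μ` a linear form in `μ`, whose coefficients are the values
-- of `a` on the columns of `V`.
lin-comb : ∀ {k n} (a : Vector ℤ n) (V : Matrix ℕ n k) μ →
  lin a (comb V μ) ≡ lin (λ j → lin a (λ i → V i j)) μ
lin-comb {k} {n} a V μ = begin
  ∑ℤ.sum (λ i → a i ℤ.* + dot (V i) μ)
    ≡⟨ ∑ℤ.sum-cong-≗ (λ i → trans (cong (λ t → a i ℤ.* t) (pos-dot (V i) μ))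
                                   (∑ℤ.*-distribˡ-sum (a i) (λ j → + V i j ℤ.* + μ j))) ⟩
  ∑ℤ.sum (λ i → ∑ℤ.sum (λ j → a i ℤ.* (+ V i j ℤ.* + μ j)))
    ≡⟨ ∑ℤ.∑-comm {n} {k} (λ i j → a i ℤ.* (+ V i j ℤ.* + μ j)) ⟩
  ∑ℤ.sum (λ j → ∑ℤ.sum (λ i → a i ℤ.* (+ V i j ℤ.* + μ j)))
    ≡⟨ ∑ℤ.sum-cong-≗ (λ j → trans
         (∑ℤ.sum-cong-≗ (λ i → sym (ℤ.*-assoc (a i) (+ V i j) (+ μ j))))
         (sym (∑ℤ.*-distribʳ-sum (+ μ j) (λ i → a i ℤ.* + V i j)))) ⟩
  ∑ℤ.sum (λ j → lin a (λ i → V i j) ℤ.* + μ j) ∎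
  where
  open ≡-Reasoning
  pos-dot : ∀ {m} (p x : Vector ℕ m) → + dot p x ≡ ∑ℤ.sum (λ j → + p j ℤ.* + x j)
  pos-dot {zero}  p x = refl
  pos-dot {suc m} p x = trans (ℤ.pos-+ (head p * head x) _)
    (cong₂ ℤ._+_ (ℤ.pos-* (head p) (head x)) (pos-dot (tail p) (tail x)))

dot-cong : ∀ {k} (v : Vector ℕ k) {μ ν} → μ ≗ ν → dot v μ ≡ dot v ν
dot-cong v μ≗ν = ∑ℕ.sum-cong-≗ λ i → cong (v i *_) (μ≗ν i)

dot-⊕ : ∀ {k} (v μ ν : Vector ℕ k) → dot v (μ ⊕ ν) ≡ dot v μ + dot v ν
dot-⊕ v μ ν = trans (∑ℕ.sum-cong-≗ λ i → ℕ.*-distribˡ-+ (v i) (μ i) (ν i))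
  (∑ℕ.∑-distrib-+ (λ i → v i * μ i) (λ i → v i * ν i))

dot-0 : ∀ {k} (v : Vector ℕ k) → dot v (λ _ → 0) ≡ 0
dot-0 {zero}  v = refl
dot-0 {suc k} v = cong₂ _+_ (ℕ.*-zeroʳ (head v)) (dot-0 (tail v))

dot-δ : ∀ {k} (v : Vector ℕ k) i → dot v (δ i) ≡ v i
dot-δ v zero    = trans (cong₂ _+_ (ℕ.*-identityʳ (head v)) (dot-0 (tail v))) (ℕ.+-identityʳ _)
dot-δ v (suc i) = cong₂ _+_ (ℕ.*-zeroʳ (head v)) (dot-δ (tail v) i)

columns : ∀ {n} (H : List (Vector ℕ n)) → Matrix ℕ n (List.length H)
columns H i j = List.lookup H j i

-- `μ` counts how often each position of `H` is used; these counts become the unknowns of the next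
-- equation.
generated⇒comb : ∀ {n} {G H : List (Vector ℕ n)} {x} → Generated G H x →
  ∃[ g ] (g ∈ G × ∃[ μ ] x ≗ g ⊕ comb (columns H) μ)
generated⇒comb {H = H} (start {x} {g} g∈ x≗g) = g , g∈ , (λ _ → 0) , λ i →
  trans (x≗g i) (sym (trans (cong (λ t → g i + t) (dot-0 (columns H i))) (ℕ.+-identityʳ (g i))))
generated⇒comb {H = H} (step {x} {h} {y} h∈ gen x≗y+h) =
  let (g , g∈ , μ , y≗) = generated⇒comb gen in g , g∈ , μ ⊕ δ (index h∈) , λ i → begin
    x i                                            ≡⟨ x≗y+h i ⟩
    y i + h i                                      ≡⟨ cong (_+ h i) (y≗ i) ⟩
    g i + dot (columns H i) μ + h i                ≡⟨ ℕ.+-assoc (g i) _ _ ⟩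
    g i + (dot (columns H i) μ + h i)
      ≡⟨ cong (λ t → g i + (dot (columns H i) μ + t))
           (trans (cong (λ v → v i) (Any.lookup-index h∈)) (sym (dot-δ (columns H i) (index h∈)))) ⟩
    g i + (dot (columns H i) μ + dot (columns H i) (δ (index h∈)))
      ≡⟨ cong (λ t → g i + t) (sym (dot-⊕ (columns H i) μ (δ (index h∈)))) ⟩
    g i + dot (columns H i) (μ ⊕ δ (index h∈)) ∎
  where open ≡-Reasoning

-- An affine map acts on starts as a whole and on periods through its linear part.
generated-affine : ∀ {k n} {G H : List (Vector ℕ k)} {G′} (V : Matrix ℕ n k) (g : Vector ℕ n) →
  (∀ {ν} → ν ∈ G → g ⊕ comb V ν ∈ G′) → ∀ {μ} →
  Generated G H μ → Generated G′ (List.map (comb V) H) (g ⊕ comb V μ)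
generated-affine V g incl (start {μ} {ν} ν∈ μ≗ν) =
  start (incl ν∈) λ i → cong (λ t → g i + t) (dot-cong (V i) μ≗ν)
generated-affine V g incl (step {μ} {η} {ν} η∈ gen μ≗) =
  step (∈-map⁺ (comb V) η∈) (generated-affine V g incl gen) λ i →
    trans (cong (λ t → g i + t) (trans (dot-cong (V i) μ≗) (dot-⊕ (V i) ν η)))
          (sym (ℕ.+-assoc (g i) (dot (V i) ν) (dot (V i) η)))

-- The solutions of all but the first equation are g + V μ with V the matrix of
-- periods, and the first equation restricted to them is again one equation, in μ.
basis : ∀ {d n} (B : Matrix ℤ d n) → Basis B
-- With no equations every vector is a solution, as it is for the single equation with zero
-- coefficients and right-hand side 0.
basis {zero} {n} B = record
  { periods     = Trivial.periods
  ; periods-sol = λ _ ()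
  ; starts      = λ _ → Trivial.starts (λ _ → 0ℤ)
  ; starts-sol  = λ _ ()
  ; generates   = λ {b} {x} _ → Trivial.generates {λ _ → 0ℤ} {x} (λ _ → lin-0ˡ x)
  }
  where module Trivial = Basis (SingleEquation.basis {n} (λ _ → 0ℤ))
basis {suc d} {n} B = record
  { periods     = List.map (comb V) First.periods
  ; periods-sol = periods-sol
  ; starts      = starts
  ; starts-sol  = starts-sol
  ; generates   = generates
  }
  where
  module Rest = Basis (basis (tail B))
  V : Matrix ℕ n (List.length Rest.periods)
  V = columns Rest.periods
  a : Vector ℤ n
  a = head B
  module First = Basis (SingleEquation.basis (λ j → lin a (λ i → V i j)))

  starts-from : Vector ℤ (suc d) → Vector ℕ n → List (Vector ℕ n)
  -- After `g` has contributed `lin a g`, the first equation leaves `head b - lin a g` to `V ν`.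
  -- Only this right-hand side depends on `b` and `g`, so the periods stay uniform.
  starts-from b g = List.map (λ ν → g ⊕ comb V ν) (First.starts (λ _ → head b ℤ.- lin a g))

  starts : Vector ℤ (suc d) → List (Vector ℕ n)
  starts b = concatMap (starts-from b) (Rest.starts (tail b))

  comb-hom : ∀ μ i → lin (tail B i) (comb V μ) ≡ 0ℤ
  comb-hom μ i = trans (lin-comb (tail B i) V μ)
    (trans (∑ℤ.sum-cong-≗ λ j → cong (λ t → t ℤ.* + μ j) (Rest.periods-sol (∈-lookup j) i)) (lin-0ˡ μ))

  periods-sol : ∀ {h} → h ∈ List.map (comb V) First.periods → Sol B (λ _ → 0ℤ) h
  periods-sol h∈ i with ∈-map⁻ (comb V) h∈
  periods-sol h∈ zero    | η , η∈ , refl = trans (lin-comb a V η) (First.periods-sol η∈ zero)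
  periods-sol h∈ (suc i) | η , η∈ , refl = comb-hom η i

  starts-sol : ∀ {b g} → g ∈ starts b → Sol B b g
  starts-sol {b} g′∈ i with find (∈-concatMap⁻ (starts-from b) {xs = Rest.starts (tail b)} g′∈)
  ... | g , g∈ , g′∈from with ∈-map⁻ (λ ν → g ⊕ comb V ν) g′∈from
  starts-sol {b} g′∈ zero | g , g∈ , _ | ν , ν∈ , refl = begin
    lin a (g ⊕ comb V ν)                     ≡⟨ lin-⊕ a g (comb V ν) ⟩
    lin a g ℤ.+ lin a (comb V ν)             ≡⟨ cong (λ t → lin a g ℤ.+ t) (trans (lin-comb a V ν) (First.starts-sol {λ _ → head b ℤ.- lin a g} ν∈ zero)) ⟩
    lin a g ℤ.+ (head b ℤ.- lin a g)         ≡⟨ cancel (lin a g) (head b) ⟩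
    head b ∎
    where
    open ≡-Reasoning
    cancel : ∀ x y → x ℤ.+ (y ℤ.- x) ≡ y
    cancel = solve-∀
  starts-sol {b} g′∈ (suc i) | g , g∈ , _ | ν , ν∈ , refl =
    trans (lin-⊕ (tail B i) g (comb V ν))
      (trans (cong₂ ℤ._+_ (Rest.starts-sol g∈ i) (comb-hom ν i)) (ℤ.+-identityʳ _))

  generates : ∀ {b x} → Sol B b x → Generated (starts b) (List.map (comb V) First.periods) x
  generates {b} {x} sol =
    let (g , g∈ , μ , x≗) = generated⇒comb (Rest.generates (sol ∘ suc))
    in generated-resp x≗ (generated-affine V g
         (λ ν∈ → ∈-concatMap⁺ (starts-from b) (lose g∈ (∈-map⁺ (λ ν → g ⊕ comb V ν) ν∈)))
         (First.generates {λ _ → head b ℤ.- lin a g} {μ} λ _ → first g μ x≗))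
    where
    first : ∀ g μ → x ≗ g ⊕ comb V μ → lin (λ j → lin a (λ i → V i j)) μ ≡ head b ℤ.- lin a g
    first g μ x≗ = begin
      lin (λ j → lin a (λ i → V i j)) μ                ≡⟨ sym (lin-comb a V μ) ⟩
      lin a (comb V μ)                                 ≡⟨ add-cancel (lin a g) (lin a (comb V μ)) ⟩
      (lin a g ℤ.+ lin a (comb V μ)) ℤ.- lin a g       ≡⟨ cong (λ t → t ℤ.- lin a g) (sym (lin-⊕ a g (comb V μ))) ⟩
      lin a (g ⊕ comb V μ) ℤ.- lin a g                 ≡⟨ cong (λ t → t ℤ.- lin a g) (sym (lin-cong a x≗)) ⟩
      lin a x ℤ.- lin a g                              ≡⟨ cong (λ t → t ℤ.- lin a g) (sol zero) ⟩
      head b ℤ.- lin a g ∎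
      where
      open ≡-Reasoning
      add-cancel : ∀ x y → y ≡ (x ℤ.+ y) ℤ.- x
      add-cancel = solve-∀

-- Periods have natural entries, so removing them only lowers coordinates. The starts thus play the
-- role of the minimal solutions.
generated⇒start≤ : ∀ {n} {G H : List (Vector ℕ n)} {x} → Generated G H x →
  ∃[ g ] (g ∈ G × (∀ i → g i ≤ x i))
generated⇒start≤ (start g∈ x≗g) = _ , g∈ , λ i → ℕ.≤-reflexive (sym (x≗g i))
generated⇒start≤ (step h∈ gen x≗) =
  let (g , g∈ , g≤y) = generated⇒start≤ gen
  in g , g∈ , λ i → ℕ.≤-trans (g≤y i) (ℕ.≤-trans (ℕ.m≤m+n _ _) (ℕ.≤-reflexive (sym (x≗ i))))

-- Every solution is generated from a start, so solvability amounts to the list of starts being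
-- nonempty.
solvable? : ∀ {d n} (B : Matrix ℤ d n) b → Dec (∃[ x ] Sol B b x)
solvable? B b with Basis.starts (basis B) b in eq
... | g ∷ G = yes (g , Basis.starts-sol (basis B) (subst (g ∈_) (sym eq) (here refl)))
... | []    = no λ (x , sol) → case generated⇒start≤ (Basis.generates (basis B) sol) of
  λ (g , g∈ , _) → case subst (g ∈_) eq g∈ of λ ()

-- Integer points of the real cone

module ∑ℚ = Sum (CommutativeRing.semiring ℚ.+-*-commutativeRing)

ι : ℤ → ℚ
ι z = z ℚ./ 1

-- Sums in ℚ are reduced to lowest terms, so the identity is checked among unnormalised fractions.
fromℚᵘ-+ : ∀ p q → fromℚᵘ (p ℚᵘ.+ q) ≡ fromℚᵘ p ℚ.+ fromℚᵘ q
fromℚᵘ-+ p q = ℚ.toℚᵘ-injective (begin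
  toℚᵘ (fromℚᵘ (p ℚᵘ.+ q))                ≈⟨ ℚ.toℚᵘ-fromℚᵘ (p ℚᵘ.+ q) ⟩
  p ℚᵘ.+ q                                ≈⟨ ℚᵘ.+-cong (ℚ.toℚᵘ-fromℚᵘ p) (ℚ.toℚᵘ-fromℚᵘ q) ⟨
  toℚᵘ (fromℚᵘ p) ℚᵘ.+ toℚᵘ (fromℚᵘ q)    ≈⟨ ℚ.toℚᵘ-homo-+ (fromℚᵘ p) (fromℚᵘ q) ⟨
  toℚᵘ (fromℚᵘ p ℚ.+ fromℚᵘ q)            ∎)
  where open ℚᵘ.≃-Reasoning

fromℚᵘ-* : ∀ p q → fromℚᵘ (p ℚᵘ.* q) ≡ fromℚᵘ p ℚ.* fromℚᵘ q
fromℚᵘ-* p q = ℚ.toℚᵘ-injective (begin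
  toℚᵘ (fromℚᵘ (p ℚᵘ.* q))                ≈⟨ ℚ.toℚᵘ-fromℚᵘ (p ℚᵘ.* q) ⟩
  p ℚᵘ.* q                                ≈⟨ ℚᵘ.*-cong (ℚ.toℚᵘ-fromℚᵘ p) (ℚ.toℚᵘ-fromℚᵘ q) ⟨
  toℚᵘ (fromℚᵘ p) ℚᵘ.* toℚᵘ (fromℚᵘ q)    ≈⟨ ℚ.toℚᵘ-homo-* (fromℚᵘ p) (fromℚᵘ q) ⟨
  toℚᵘ (fromℚᵘ p ℚ.* fromℚᵘ q)            ∎)
  where open ℚᵘ.≃-Reasoning

ι-+ : ∀ a b → ι (a ℤ.+ b) ≡ ι a ℚ.+ ι b
ι-+ a b = trans (ℚ.fromℚᵘ-cong {mkℚᵘ (a ℤ.+ b) 0} {mkℚᵘ a 0 ℚᵘ.+ mkℚᵘ b 0} (*≡* (units a b)))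
                (fromℚᵘ-+ (mkℚᵘ a 0) (mkℚᵘ b 0))
  where
  units : ∀ a b → (a ℤ.+ b) ℤ.* ℤ.1ℤ ≡ (a ℤ.* ℤ.1ℤ ℤ.+ b ℤ.* ℤ.1ℤ) ℤ.* ℤ.1ℤ
  units = solve-∀

ι-* : ∀ a b → ι (a ℤ.* b) ≡ ι a ℚ.* ι b
ι-* a b = fromℚᵘ-* (mkℚᵘ a 0) (mkℚᵘ b 0)

ι-mono-≤ : ∀ {a b} → a ℤ.≤ b → ι a ℚ.≤ ι b
ι-mono-≤ {a} {b} a≤b = ℚ.toℚᵘ-cancel-≤ (begin
  toℚᵘ (ι a)  ≃⟨ ℚ.toℚᵘ-fromℚᵘ (mkℚᵘ a 0) ⟩
  mkℚᵘ a 0    ≤⟨ *≤* (ℤ.*-monoʳ-≤-nonNeg ℤ.1ℤ a≤b) ⟩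
  mkℚᵘ b 0    ≃⟨ ℚ.toℚᵘ-fromℚᵘ (mkℚᵘ b 0) ⟨
  toℚᵘ (ι b)  ∎)
  where open ℚᵘ.≤-Reasoning

ι-cancel-≤ : ∀ {a b} → ι a ℚ.≤ ι b → a ℤ.≤ b
ι-cancel-≤ {a} {b} ιa≤ιb =
  subst₂ ℤ._≤_ (ℤ.*-identityʳ a) (ℤ.*-identityʳ b) (ℚᵘ.drop-*≤* below)
  where
  open ℚᵘ.≤-Reasoning
  below : mkℚᵘ a 0 ℚᵘ.≤ mkℚᵘ b 0
  below = begin
    mkℚᵘ a 0    ≃⟨ ℚ.toℚᵘ-fromℚᵘ (mkℚᵘ a 0) ⟨
    toℚᵘ (ι a)  ≤⟨ ℚ.toℚᵘ-mono-≤ ιa≤ιb ⟩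
    toℚᵘ (ι b)  ≃⟨ ℚ.toℚᵘ-fromℚᵘ (mkℚᵘ b 0) ⟩
    mkℚᵘ b 0    ∎

0≤ι+ : ∀ n → 0ℚ ℚ.≤ ι (+ n)
0≤ι+ n = ι-mono-≤ {0ℤ} {+ n} (ℤ.+≤+ z≤n)

0<ι+suc : ∀ n → 0ℚ ℚ.< ι (+ suc n)
0<ι+suc n = ℚ.<-≤-trans (ℚ.positive⁻¹ 1ℚ) (ι-mono-≤ {ℤ.1ℤ} {+ suc n} (ℤ.+≤+ (s≤s z≤n)))

∣ι∣ : ∀ z → ℚ.∣ ι z ∣ ≡ ι (+ ∣ z ∣)
∣ι∣ (+ n)    = ℚ.0≤p⇒∣p∣≡p (0≤ι+ n)
∣ι∣ -[1+ n ] = trans (ℚ.∣-p∣≡∣p∣ (ι (+ suc n))) (∣ι∣ (+ suc n))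

∣∣≤ : ∀ {p c} → ℚ.- c ℚ.≤ p → p ℚ.≤ c → ℚ.∣ p ∣ ℚ.≤ c
∣∣≤ {p} {c} -c≤p p≤c with ℚ.∣p∣≡p∨∣p∣≡-p p
... | inj₁ eq = subst (ℚ._≤ c) (sym eq) p≤c
... | inj₂ eq = subst₂ ℚ._≤_ (sym eq) (neg-involutive c) (ℚ.neg-antimono-≤ -c≤p)
  where
  open +-*-Solver
  neg-involutive : ∀ c → ℚ.- (ℚ.- c) ≡ c
  neg-involutive = solve 1 (λ c → :- (:- c) := c) refl

-- Rounding and approximation

floor : ∀ q → 0ℚ ℚ.≤ q → ∃[ l ] (ι (+ l) ℚ.≤ q × q ℚ.≤ ι (+ suc l))
floor q@(mkℚ (+ a) d-1 _) _ = l , lower , upper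
  where
  d l : ℕ
  d = suc d-1
  l = a ℕ./ d
  euclid : a ≡ a ℕ.% d + l * d
  euclid = ℕ.m≡m%n+[m/n]*n a d
  lower : ι (+ l) ℚ.≤ q
  lower = ℚ.toℚᵘ-cancel-≤ (ℚᵘ.≤-respˡ-≃ (ℚᵘ.≃-sym (ℚ.toℚᵘ-fromℚᵘ (mkℚᵘ (+ l) 0)))
    (*≤* (subst₂ ℤ._≤_ (ℤ.pos-* l d) (sym (ℤ.*-identityʳ (+ a)))
      (ℤ.+≤+ (ℕ.≤-trans (ℕ.m≤n+m (l * d) (a ℕ.% d)) (ℕ.≤-reflexive (sym euclid)))))))
  upper : q ℚ.≤ ι (+ suc l)
  upper = ℚ.toℚᵘ-cancel-≤ (ℚᵘ.≤-respʳ-≃ (ℚᵘ.≃-sym (ℚ.toℚᵘ-fromℚᵘ (mkℚᵘ (+ suc l) 0)))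
    (*≤* (subst₂ ℤ._≤_ (sym (ℤ.*-identityʳ (+ a))) (ℤ.pos-* (suc l) d)
      (ℤ.+≤+ (ℕ.≤-trans (ℕ.≤-reflexive euclid)
        (ℕ.+-monoˡ-≤ (l * d) (ℕ.<⇒≤ (ℕ.m%n<n a d))))))))
floor (mkℚ -[1+ a ] d-1 _) (ℚ.*≤* ())

-- A nonnegative real may have slightly negative approximations, hence the slack in the hypothesis.
-- With `l` the floor of `q + 1`, the difference `q - l` lies between -1 and 0.
round : ∀ q → 0ℚ ℚ.≤ q ℚ.+ 1ℚ → ∃[ l ] ℚ.∣ q ℚ.- ι (+ l) ∣ ℚ.≤ 1ℚ
round q 0≤q+1 =
  let (l , lower , upper) = floor (q ℚ.+ 1ℚ) 0≤q+1
  in l , ∣∣≤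
    (subst₂ ℚ._≤_ (left (ι (+ l))) (right q (ι (+ l))) (ℚ.+-monoˡ-≤ (ℚ.- ι (+ l) ℚ.- 1ℚ) lower))
    (ℚ.≤-trans
      (subst₂ ℚ._≤_ (right q (ι (+ l)))
        (trans (cong (λ t → t ℚ.+ (ℚ.- ι (+ l) ℚ.- 1ℚ)) (ι-+ ℤ.1ℤ (+ l))) (zero! (ι (+ l))))
        (ℚ.+-monoˡ-≤ (ℚ.- ι (+ l) ℚ.- 1ℚ) upper))
      (ℚ.<⇒≤ (ℚ.positive⁻¹ 1ℚ)))
  where
  open +-*-Solver
  left : ∀ l → l ℚ.+ (ℚ.- l ℚ.- 1ℚ) ≡ ℚ.- 1ℚ
  left = solve 1 (λ l → l :+ (:- l :- con 1ℚ) := :- con 1ℚ) refl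
  right : ∀ q l → q ℚ.+ 1ℚ ℚ.+ (ℚ.- l ℚ.- 1ℚ) ≡ q ℚ.- l
  right = solve 2 (λ q l → q :+ con 1ℚ :+ (:- l :- con 1ℚ) := q :- l) refl
  zero! : ∀ l → 1ℚ ℚ.+ l ℚ.+ (ℚ.- l ℚ.- 1ℚ) ≡ 0ℚ
  zero! = solve 1 (λ l → con 1ℚ :+ l :+ (:- l :- con 1ℚ) := con 0ℚ) refl

qlin : ∀ {n} → Vector ℤ n → Vector ℚ n → ℚ
qlin a s = ∑ℚ.sum (λ j → ι (a j) ℚ.* s j)

norm : ∀ {n} → Vector ℤ n → ℕ
norm a = ∑ℕ.sum (∣_∣ ∘ a)

ι-lin : ∀ {n} (a : Vector ℤ n) l → ι (lin a l) ≡ qlin a (λ j → ι (+ l j))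
ι-lin {zero}  a l = refl
ι-lin {suc n} a l = trans (ι-+ (head a ℤ.* + head l) _)
  (cong₂ ℚ._+_ (ι-* (head a) (+ head l)) (ι-lin (tail a) (tail l)))

qlin-linear : ∀ {n} (a : Vector ℤ n) (k : ℚ) s t →
  k ℚ.* qlin a s ℚ.- qlin a t ≡ qlin a (λ j → k ℚ.* s j ℚ.- t j)
qlin-linear {zero}  a k s t = trans (ℚ.+-identityʳ _) (ℚ.*-zeroʳ k)
qlin-linear {suc n} a k s t = trans
  (rearrange k (ι (head a)) (s zero) (t zero) (qlin (tail a) (tail s)) (qlin (tail a) (tail t)))
  (cong (λ u → ι (head a) ℚ.* (k ℚ.* s zero ℚ.- t zero) ℚ.+ u) (qlin-linear (tail a) k (tail s) (tail t)))
  where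
  open +-*-Solver
  rearrange : ∀ k a s t S T → k ℚ.* (a ℚ.* s ℚ.+ S) ℚ.- (a ℚ.* t ℚ.+ T) ≡
                              a ℚ.* (k ℚ.* s ℚ.- t) ℚ.+ (k ℚ.* S ℚ.- T)
  rearrange = solve 6 (λ k a s t S T → k :* (a :* s :+ S) :- (a :* t :+ T) :=
                                       a :* (k :* s :- t) :+ (k :* S :- T)) refl

∣qlin∣≤ : ∀ {n} (a : Vector ℤ n) s → (∀ j → ℚ.∣ s j ∣ ℚ.≤ 1ℚ) → ℚ.∣ qlin a s ∣ ℚ.≤ ι (+ norm a)
∣qlin∣≤ {zero}  a s s≤1 = ℚ.≤-refl
∣qlin∣≤ {suc n} a s s≤1 = begin
  ℚ.∣ ι a₀ ℚ.* s₀ ℚ.+ qlin (tail a) (tail s) ∣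
    ≤⟨ ℚ.∣p+q∣≤∣p∣+∣q∣ (ι a₀ ℚ.* s₀) (qlin (tail a) (tail s)) ⟩
  ℚ.∣ ι a₀ ℚ.* s₀ ∣ ℚ.+ ℚ.∣ qlin (tail a) (tail s) ∣
    ≤⟨ ℚ.+-mono-≤ first (∣qlin∣≤ (tail a) (tail s) (s≤1 ∘ suc)) ⟩
  ι (+ ∣ a₀ ∣) ℚ.+ ι (+ norm (tail a))
    ≡⟨ ι-+ (+ ∣ a₀ ∣) (+ norm (tail a)) ⟨
  ι (+ ∣ a₀ ∣ ℤ.+ + norm (tail a))
    ≡⟨ cong ι (ℤ.pos-+ ∣ a₀ ∣ (norm (tail a))) ⟨
  ι (+ norm a) ∎
  where
  open ℚ.≤-Reasoning
  a₀ = head a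
  s₀ = head s
  first : ℚ.∣ ι a₀ ℚ.* s₀ ∣ ℚ.≤ ι (+ ∣ a₀ ∣)
  first = begin
    ℚ.∣ ι a₀ ℚ.* s₀ ∣             ≡⟨ ℚ.∣p*q∣≡∣p∣*∣q∣ (ι a₀) s₀ ⟩
    ℚ.∣ ι a₀ ∣ ℚ.* ℚ.∣ s₀ ∣       ≤⟨ ℚ.*-monoˡ-≤-nonNeg ℚ.∣ ι a₀ ∣ {{ℚ.∣-∣-nonNeg (ι a₀)}} (s≤1 zero) ⟩
    ℚ.∣ ι a₀ ∣ ℚ.* 1ℚ             ≡⟨ ℚ.*-identityʳ _ ⟩
    ℚ.∣ ι a₀ ∣                    ≡⟨ ∣ι∣ a₀ ⟩
    ι (+ ∣ a₀ ∣)                  ∎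

-- Real sums and products are taken term by term, so fixing the index `m` turns a real combination
-- into a rational one.
seq-*ᵥ : ∀ {d n} (A : Matrix ℤ d n) (c : Vector ℝ n) i m →
  seq ((Vector.map (Vector.map fromℤ) A R.*ᵥ c) i) m ≡ qlin (A i) (λ j → seq (c j) m)
seq-*ᵥ A c i m = row (A i) c
  where
  row : ∀ {n} (a : Vector ℤ n) (c : Vector ℝ n) →
    seq (((λ (_ : Fin 1) → Vector.map fromℤ a) R.*ᵥ c) zero) m ≡ qlin a (λ j → seq (c j) m)
  row {zero}  a c = refl
  row {suc n} a c = cong (λ t → ι (head a) ℚ.* seq (head c) m ℚ.+ t) (row (tail a) (tail c))

eventually-all : ∀ {n} {P : Fin n → ℕ → Set} →
  (∀ j → ∃[ N ] (∀ m → N ≤ m → P j m)) → ∃[ N ] (∀ m → N ≤ m → ∀ j → P j m)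
eventually-all {zero}  ev = 0 , λ _ _ ()
eventually-all {suc n} ev =
  let (M , p) = ev zero
      (N , q) = eventually-all (ev ∘ suc)
  in M ⊔ N , λ m le → λ { zero    → p m (ℕ.m⊔n≤o⇒m≤o M N le)
                        ; (suc j) → q m (ℕ.m⊔n≤o⇒n≤o M N le) j }

-- Round K times a real combination of the columns, at precision 1/K: the
-- error does not depend on K.
cone⇒approximation : ∀ {d n} (A : Matrix ℤ d n) x → Cone A (Vector.map fromℤ x) → ∀ k →
  ∃[ l ] (∀ i → ∣ + suc k ℤ.* x i ℤ.- lin (A i) l ∣ ≤ suc (norm (A i)))
cone⇒approximation {d} {n} A x (c , c≥0 , Ac≃x) k = proceed (divide K 1ℚ (0<ι+suc k) (ℚ.positive⁻¹ 1ℚ))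
  where
  K : ℚ
  K = ι (+ suc k)
  Goal : Set
  Goal = ∃[ l ] (∀ i → ∣ + suc k ℤ.* x i ℤ.- lin (A i) l ∣ ≤ suc (norm (A i)))
  K≥0 : ℚ.NonNegative K
  K≥0 = ℚ.nonNegative (0≤ι+ (suc k))
  proceed : ∃[ ε ] (0ℚ ℚ.< ε × K ℚ.* ε ≡ 1ℚ) → Goal
  proceed (ε , 0<ε , Kε≡1) =
    let (M , near₀) = eventually-all (λ j → c≥0 j ε 0<ε)
        (N , near)  = eventually-all (λ i → Ac≃x i ε 0<ε)
    in at (M ⊔ N) (near₀ (M ⊔ N) (ℕ.m≤m⊔n M N)) (near (M ⊔ N) (ℕ.m≤n⊔m M N))
    where
    at : ∀ m → (∀ j → 0ℚ ℚ.< seq (c j) m ℚ.+ ε) →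
         (∀ i → ℚ.∣ seq ((Vector.map (Vector.map fromℤ) A R.*ᵥ c) i) m ℚ.- ι (x i) ∣ ℚ.< ε) → Goal
    at m pos near = (proj₁ ∘ rounded) , close
      where
      s : Vector ℚ n
      s j = seq (c j) m
      rounded : ∀ j → ∃[ l ] ℚ.∣ K ℚ.* s j ℚ.- ι (+ l) ∣ ℚ.≤ 1ℚ
      -- From `s j > - ε` and `K ε = 1` it follows that `K * s j ≥ -1`, as `round` asks.
      rounded j = round (K ℚ.* s j) (subst₂ ℚ._≤_ (ℚ.*-zeroʳ K)
        (trans (ℚ.*-distribˡ-+ K (s j) ε) (cong (λ t → K ℚ.* s j ℚ.+ t) Kε≡1))
        (ℚ.*-monoˡ-≤-nonNeg K {{K≥0}} (ℚ.<⇒≤ (pos j))))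
      l : Vector ℕ n
      l = proj₁ ∘ rounded
      close : ∀ i → ∣ + suc k ℤ.* x i ℤ.- lin (A i) l ∣ ≤ suc (norm (A i))
      close i = ℤ.drop‿+≤+ (ι-cancel-≤ (begin
        ι (+ ∣ r ∣)                     ≡⟨ ∣ι∣ r ⟨
        -- The first summand is `K` times the error of the approximation at index `m`, at most
        -- `K ε = 1`; the second is the rounding error, at most 1 per coordinate and so at most the
        -- norm of the row.
        ℚ.∣ ι r ∣                       ≡⟨ cong ℚ.∣_∣ split ⟩
        ℚ.∣ K ℚ.* (ι (x i) ℚ.- qlin (A i) s) ℚ.+ qlin (A i) (λ j → K ℚ.* s j ℚ.- ι (+ l j)) ∣
          ≤⟨ ℚ.∣p+q∣≤∣p∣+∣q∣ (K ℚ.* (ι (x i) ℚ.- qlin (A i) s)) _ ⟩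
        ℚ.∣ K ℚ.* (ι (x i) ℚ.- qlin (A i) s) ∣ ℚ.+ ℚ.∣ qlin (A i) (λ j → K ℚ.* s j ℚ.- ι (+ l j)) ∣
          ≤⟨ ℚ.+-mono-≤ scaled (∣qlin∣≤ (A i) _ (proj₂ ∘ rounded)) ⟩
        1ℚ ℚ.+ ι (+ norm (A i))         ≡⟨ ι-+ ℤ.1ℤ (+ norm (A i)) ⟨
        ι (+ suc (norm (A i)))          ∎))
        where
        open ℚ.≤-Reasoning
        r : ℤ
        r = + suc k ℤ.* x i ℤ.- lin (A i) l
        scaled : ℚ.∣ K ℚ.* (ι (x i) ℚ.- qlin (A i) s) ∣ ℚ.≤ 1ℚ
        scaled = begin
          ℚ.∣ K ℚ.* (ι (x i) ℚ.- qlin (A i) s) ∣       ≡⟨ ℚ.∣p*q∣≡∣p∣*∣q∣ K _ ⟩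
          ℚ.∣ K ∣ ℚ.* ℚ.∣ ι (x i) ℚ.- qlin (A i) s ∣   ≡⟨ cong₂ ℚ._*_ (ℚ.0≤p⇒∣p∣≡p (0≤ι+ (suc k))) flip ⟩
          K ℚ.* ℚ.∣ qlin (A i) s ℚ.- ι (x i) ∣         ≤⟨ ℚ.*-monoˡ-≤-nonNeg K {{K≥0}} (ℚ.<⇒≤ near′) ⟩
          K ℚ.* ε                                      ≡⟨ Kε≡1 ⟩
          1ℚ ∎
          where
          near′ : ℚ.∣ qlin (A i) s ℚ.- ι (x i) ∣ ℚ.< ε
          near′ = subst (λ t → ℚ.∣ t ℚ.- ι (x i) ∣ ℚ.< ε) (seq-*ᵥ A c i m) (near i)
          flip : ℚ.∣ ι (x i) ℚ.- qlin (A i) s ∣ ≡ ℚ.∣ qlin (A i) s ℚ.- ι (x i) ∣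
          flip = trans (sym (ℚ.∣-p∣≡∣p∣ _)) (cong ℚ.∣_∣ (negate (ι (x i)) (qlin (A i) s)))
            where
            open +-*-Solver
            negate : ∀ p q → ℚ.- (p ℚ.- q) ≡ q ℚ.- p
            negate = solve 2 (λ p q → :- (p :- q) := q :- p) refl
        ι-neg : ∀ z → ι (ℤ.- z) ≡ ℚ.- ι z
        ι-neg z = begin-equality
          ι (ℤ.- z)                        ≡⟨ shuffle (ι (ℤ.- z)) (ι z) ⟩
          ι (ℤ.- z) ℚ.+ ι z ℚ.- ι z        ≡⟨ cong (λ t → t ℚ.- ι z) (ι-+ (ℤ.- z) z) ⟨
          ι (ℤ.- z ℤ.+ z) ℚ.- ι z          ≡⟨ cong (λ t → ι t ℚ.- ι z) (ℤ.+-inverseˡ z) ⟩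
          0ℚ ℚ.- ι z                       ≡⟨ ℚ.+-identityˡ _ ⟩
          ℚ.- ι z                          ∎
          where
          open +-*-Solver
          shuffle : ∀ p q → p ≡ p ℚ.+ q ℚ.- q
          shuffle = solve 2 (λ p q → p := p :+ q :- q) refl
        split : ι r ≡ K ℚ.* (ι (x i) ℚ.- qlin (A i) s) ℚ.+ qlin (A i) (λ j → K ℚ.* s j ℚ.- ι (+ l j))
        split = begin-equality
          ι r
            ≡⟨ ι-+ (+ suc k ℤ.* x i) (ℤ.- lin (A i) l) ⟩
          ι (+ suc k ℤ.* x i) ℚ.+ ι (ℤ.- lin (A i) l)
            ≡⟨ cong₂ ℚ._+_ (ι-* (+ suc k) (x i)) (trans (ι-neg (lin (A i) l)) (cong ℚ.-_ (ι-lin (A i) l))) ⟩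
          K ℚ.* ι (x i) ℚ.- qlin (A i) (λ j → ι (+ l j))
            ≡⟨ rearrange K (ι (x i)) (qlin (A i) s) _ ⟩
          K ℚ.* (ι (x i) ℚ.- qlin (A i) s) ℚ.+ (K ℚ.* qlin (A i) s ℚ.- qlin (A i) (λ j → ι (+ l j)))
            ≡⟨ cong (λ t → K ℚ.* (ι (x i) ℚ.- qlin (A i) s) ℚ.+ t) (qlin-linear (A i) K s _) ⟩
          K ℚ.* (ι (x i) ℚ.- qlin (A i) s) ℚ.+ qlin (A i) (λ j → K ℚ.* s j ℚ.- ι (+ l j)) ∎
          where
          open +-*-Solver
          rearrange : ∀ k x a l → k ℚ.* x ℚ.- l ≡ k ℚ.* (x ℚ.- a) ℚ.+ (k ℚ.* a ℚ.- l)
          rearrange = solve 4 (λ k x a l → k :* x :- l := k :* (x :- a) :+ (k :* a :- l)) refl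

-- The coefficients `l j / (k + 1)` are taken as constant sequences, so the required identity holds
-- exactly at every index.
multiple⇒cone : ∀ {d n} (A : Matrix ℤ d n) x k l →
  (∀ i → lin (A i) l ≡ + suc k ℤ.* x i) → Cone A (Vector.map fromℤ x)
multiple⇒cone {d} {n} A x k l Al≡Kx = proceed (divide K 1ℚ (0<ι+suc k) (ℚ.positive⁻¹ 1ℚ))
  where
  K : ℚ
  K = ι (+ suc k)
  proceed : ∃[ ε ] (0ℚ ℚ.< ε × K ℚ.* ε ≡ 1ℚ) → Cone A (Vector.map fromℤ x)
  proceed (ε , 0<ε , Kε≡1) = fromℚ ∘ q , nonneg , exact
    where
    q : Vector ℚ n
    q j = ε ℚ.* ι (+ l j)
    nonneg : ∀ j → 0ᴿ ≤ᴿ fromℚ (q j)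
    nonneg j η 0<η = 0 , λ _ _ → ℚ.+-mono-≤-< {0ℚ} {q j} {0ℚ} {η}
      (subst (ℚ._≤ q j) (ℚ.*-zeroʳ ε)
        (ℚ.*-monoˡ-≤-nonNeg ε {{ℚ.nonNegative (ℚ.<⇒≤ 0<ε)}} (0≤ι+ (l j)))) 0<η
    value : ∀ i m → seq ((Vector.map (Vector.map fromℤ) A R.*ᵥ (fromℚ ∘ q)) i) m ≡ ι (x i)
    value i m = begin
      seq ((Vector.map (Vector.map fromℤ) A R.*ᵥ (fromℚ ∘ q)) i) m  ≡⟨ seq-*ᵥ A (fromℚ ∘ q) i m ⟩
      qlin (A i) q
        ≡⟨ ∑ℚ.sum-cong-≗ (λ j → swap (ι (A i j)) ε (ι (+ l j))) ⟩
      ∑ℚ.sum (λ j → ε ℚ.* (ι (A i j) ℚ.* ι (+ l j)))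
        ≡⟨ ∑ℚ.*-distribˡ-sum ε (λ j → ι (A i j) ℚ.* ι (+ l j)) ⟨
      ε ℚ.* qlin (A i) (λ j → ι (+ l j))        ≡⟨ cong (ε ℚ.*_) (ι-lin (A i) l) ⟨
      ε ℚ.* ι (lin (A i) l)                     ≡⟨ cong (λ t → ε ℚ.* ι t) (Al≡Kx i) ⟩
      ε ℚ.* ι (+ suc k ℤ.* x i)                 ≡⟨ cong (ε ℚ.*_) (ι-* (+ suc k) (x i)) ⟩
      ε ℚ.* (K ℚ.* ι (x i))                     ≡⟨ assoc-comm ε K (ι (x i)) ⟩
      K ℚ.* ε ℚ.* ι (x i)                       ≡⟨ cong (ℚ._* ι (x i)) Kε≡1 ⟩
      1ℚ ℚ.* ι (x i)                            ≡⟨ ℚ.*-identityˡ _ ⟩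
      ι (x i) ∎
      where
      open ≡-Reasoning
      open +-*-Solver
      swap : ∀ a e l → a ℚ.* (e ℚ.* l) ≡ e ℚ.* (a ℚ.* l)
      swap = solve 3 (λ a e l → a :* (e :* l) := e :* (a :* l)) refl
      assoc-comm : ∀ e k x → e ℚ.* (k ℚ.* x) ≡ k ℚ.* e ℚ.* x
      assoc-comm = solve 3 (λ e k x → e :* (k :* x) := k :* e :* x) refl
    exact : Vector.map (Vector.map fromℤ) A R.*ᵥ (fromℚ ∘ q) R.≋ Vector.map fromℤ x
    exact i η 0<η = 0 , λ m _ → subst (ℚ._< η)
      (sym (trans (cong (λ t → ℚ.∣ t ℚ.- ι (x i) ∣) (value i m)) (cong ℚ.∣_∣ (ℚ.+-inverseʳ (ι (x i)))))) 0<η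

-- Holes

∈⇒≤max : ∀ {m xs} → m ∈ xs → m ≤ max 0 xs
∈⇒≤max {xs = xs} m∈ = All.lookup (xs≤max 0 xs) m∈

intBox : ℕ → ∀ d → List (Vector ℤ d)
intBox C d = List.map (Vector.map (λ m → + m ℤ.- + C)) (box (C + C) d)

intBox-complete : ∀ {C d} (b : Vector ℤ d) → (∀ i → ∣ b i ∣ ≤ C) →
  ∃[ b′ ] (b′ ∈ intBox C d × b ≗ b′)
intBox-complete {C} {d} b b≤C =
  let (m , m∈ , ≗m) = box-complete (proj₁ ∘ raised) (proj₁ ∘ proj₂ ∘ raised)
  in _ , ∈-map⁺ (Vector.map (λ m → + m ℤ.- + C)) m∈
   , λ i → trans (proj₂ (proj₂ (raised i))) (cong (λ m → + m ℤ.- + C) (≗m i))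
  where
  raise : ∀ z → ∣ z ∣ ≤ C → ∃[ m ] (m ≤ C + C × z ≡ + m ℤ.- + C)
  raise (+ k) k≤C = k + C , ℕ.+-monoˡ-≤ C k≤C ,
    trans (cancel (+ k) (+ C)) (cong (λ t → t ℤ.- + C) (sym (ℤ.pos-+ k C)))
    where
    cancel : ∀ k c → k ≡ k ℤ.+ c ℤ.- c
    cancel = solve-∀
  raise -[1+ k ] k<C = C ∸ suc k , ℕ.≤-trans (ℕ.m∸n≤m C (suc k)) (ℕ.m≤m+n C C) ,
    trans (cancel +[1+ k ] (+ C)) (cong (λ t → t ℤ.- + C)
      (trans (ℤ.m-n≡m⊖n C (suc k)) (ℤ.⊖-≥ k<C)))
    where
    cancel : ∀ k c → ℤ.- k ≡ c ℤ.- k ℤ.- c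
    cancel = solve-∀
  raised : ∀ i → ∃[ m ] (m ≤ C + C × b i ≡ + m ℤ.- + C)
  raised i = raise (b i) (b≤C i)

lin-++ : ∀ {m n} (a : Vector ℤ m) (b : Vector ℤ n) y →
  lin (a Vector.++ b) y ≡ lin a (Vector.take m y) ℤ.+ lin b (Vector.drop m y)
lin-++ {m} {n} a b y = trans (sum-split m (λ i → (a Vector.++ b) i ℤ.* + y i))
  (cong₂ ℤ._+_
    (∑ℤ.sum-cong-≗ λ i → cong (λ t → t ℤ.* + y (i ↑ˡ n)) (lookup-++ˡ a b i))
    (∑ℤ.sum-cong-≗ λ j → cong (λ t → t ℤ.* + y (m ↑ʳ j)) (lookup-++ʳ a b j)))
  where
  sum-split : ∀ m (v : Vector ℤ (m + n)) →
    ∑ℤ.sum v ≡ ∑ℤ.sum (Vector.take m v) ℤ.+ ∑ℤ.sum (Vector.drop m v)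
  sum-split zero    v = sym (ℤ.+-identityˡ _)
  sum-split (suc m) v = trans (cong (λ t → head v ℤ.+ t) (sum-split m (tail v)))
    (sym (ℤ.+-assoc (head v) _ _))

lin-neg : ∀ {n} (a : Vector ℤ n) x → lin (Vector.map ℤ.-_ a) x ≡ ℤ.- lin a x
lin-neg {zero}  a x = refl
lin-neg {suc n} a x = trans
  (cong₂ ℤ._+_ (sym (ℤ.neg-distribˡ-* (head a) (+ head x))) (lin-neg (tail a) (tail x)))
  (sym (ℤ.neg-distrib-+ (head a ℤ.* + head x) (lin (tail a) (tail x))))

∣lin∣≤ : ∀ {n} (a : Vector ℤ n) x {M} → (∀ j → x j ≤ M) → ∣ lin a x ∣ ≤ norm a * M
∣lin∣≤ {zero}  a x     x≤M = z≤n
∣lin∣≤ {suc n} a x {M} x≤M = begin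
  ∣ head a ℤ.* + head x ℤ.+ lin (tail a) (tail x) ∣
    ≤⟨ ℤ.∣i+j∣≤∣i∣+∣j∣ (head a ℤ.* + head x) _ ⟩
  ∣ head a ℤ.* + head x ∣ + ∣ lin (tail a) (tail x) ∣
    ≡⟨ cong (λ t → t + ∣ lin (tail a) (tail x) ∣) (ℤ.abs-* (head a) (+ head x)) ⟩
  ∣ head a ∣ * head x + ∣ lin (tail a) (tail x) ∣
    ≤⟨ ℕ.+-mono-≤ (ℕ.*-monoʳ-≤ ∣ head a ∣ (x≤M zero)) (∣lin∣≤ (tail a) (tail x) (x≤M ∘ suc)) ⟩
  ∣ head a ∣ * M + norm (tail a) * M
    ≡⟨ sym (ℕ.*-distribʳ-+ M ∣ head a ∣ (norm (tail a))) ⟩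
  norm a * M ∎
  where open ℕ.≤-Reasoning

-- Adding periods with first coordinate 0 never changes the first coordinate.
generated⇒start-head : ∀ {n} {G H : List (Vector ℕ (suc n))} → (∀ {h} → h ∈ H → head h ≡ 0) →
  ∀ {x} → Generated G H x → ∃[ g ] (g ∈ G × head x ≡ head g)
generated⇒start-head H₀ (start g∈ x≗g) = _ , g∈ , x≗g zero
generated⇒start-head H₀ (step {x} {h} {y} h∈ gen x≗) =
  let (g , g∈ , eq) = generated⇒start-head H₀ gen
  in g , g∈ , trans (x≗ zero) (trans (cong₂ _+_ eq (H₀ h∈)) (ℕ.+-identityʳ (head g)))

-- Cone and lattice membership as systems over ℕ

module _ {d n} (A : Matrix ℤ d n) where

  -- Membership in the rational cone with the denominators cleared; `suc k` keeps the multiplier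
  -- positive.
  Multiple : Vector ℤ d → Set
  Multiple x = ∃[ k ] ∃[ l ] (∀ i → lin (A i) l ≡ + suc k ℤ.* x i)

  -- The lattice as the group of differences of semigroup elements, which uses natural unknowns
  -- only.
  Difference : Vector ℤ d → Set
  Difference x = ∃[ λ′ ] ∃[ μ ] (∀ i → x i ℤ.+ lin (A i) λ′ ≡ lin (A i) μ)

  -- The unknowns are `k` followed by `l`. Right-hand side `x` encodes `A l = (k + 1) x`; right-hand
  -- side 0 encodes `A l = k x`.
  multipleSystem : Vector ℤ d → Matrix ℤ d (suc n)
  multipleSystem x i = (ℤ.- x i) Vector.∷ A i

  -- The block matrix with blocks `- A` and `A`: right-hand side `x` and unknowns `p`, `q` encode
  -- `x + A p = A q`.
  differenceSystem : Matrix ℤ d (n + n)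
  differenceSystem i = Vector.map ℤ.-_ (A i) Vector.++ A i

  multiple? : ∀ x → Dec (Multiple x)
  multiple? x = map′
    (λ (y , sol) → head y , tail y , λ i → to (x i) (+ head y) (lin (A i) (tail y)) (sol i))
    (λ (k , l , eq) → k Vector.∷ l , λ i → from (x i) (+ k) (lin (A i) l) (eq i))
    (solvable? (multipleSystem x) x)
    where
    move : ∀ x k → x ℤ.+ x ℤ.* k ≡ (ℤ.1ℤ ℤ.+ k) ℤ.* x
    move = solve-∀
    isolate : ∀ x k s → s ≡ (ℤ.- x ℤ.* k ℤ.+ s) ℤ.+ x ℤ.* k
    isolate = solve-∀
    restore : ∀ x k → ℤ.- x ℤ.* k ℤ.+ (ℤ.1ℤ ℤ.+ k) ℤ.* x ≡ x
    restore = solve-∀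
    to : ∀ x k s → ℤ.- x ℤ.* k ℤ.+ s ≡ x → s ≡ (ℤ.1ℤ ℤ.+ k) ℤ.* x
    to x k s eq = trans (isolate x k s) (trans (cong (λ t → t ℤ.+ x ℤ.* k) eq) (move x k))
    from : ∀ x k s → s ≡ (ℤ.1ℤ ℤ.+ k) ℤ.* x → ℤ.- x ℤ.* k ℤ.+ s ≡ x
    from x k s eq = trans (cong (λ t → ℤ.- x ℤ.* k ℤ.+ t) eq) (restore x k)

  lin-differenceSystem : ∀ i y → lin (differenceSystem i) y ≡
    ℤ.- lin (A i) (Vector.take n y) ℤ.+ lin (A i) (Vector.drop n y)
  lin-differenceSystem i y = trans (lin-++ (Vector.map ℤ.-_ (A i)) (A i) y)
    (cong (λ t → t ℤ.+ lin (A i) (Vector.drop n y)) (lin-neg (A i) (Vector.take n y)))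

  sol⇒difference : ∀ {x} y → Sol differenceSystem x y →
    ∀ i → x i ℤ.+ lin (A i) (Vector.take n y) ≡ lin (A i) (Vector.drop n y)
  sol⇒difference {x} y sol i = trans
    (cong (λ t → t ℤ.+ lin (A i) (Vector.take n y))
          (trans (sym (sol i)) (lin-differenceSystem i y)))
    (cancel (lin (A i) (Vector.take n y)) (lin (A i) (Vector.drop n y)))
    where
    cancel : ∀ p q → ℤ.- p ℤ.+ q ℤ.+ p ≡ q
    cancel = solve-∀

  difference⇒sol : ∀ {x} p q → (∀ i → x i ℤ.+ lin (A i) p ≡ lin (A i) q) →
    Sol differenceSystem x (p Vector.++ q)
  difference⇒sol {x} p q eq i = begin
    lin (differenceSystem i) (p Vector.++ q)
      ≡⟨ lin-differenceSystem i (p Vector.++ q) ⟩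
    ℤ.- lin (A i) (Vector.take n (p Vector.++ q)) ℤ.+ lin (A i) (Vector.drop n (p Vector.++ q))
      ≡⟨ cong₂ (λ s t → ℤ.- s ℤ.+ t) (lin-cong (A i) (lookup-++ˡ p q)) (lin-cong (A i) (lookup-++ʳ p q)) ⟩
    ℤ.- lin (A i) p ℤ.+ lin (A i) q          ≡⟨ cong (λ t → ℤ.- lin (A i) p ℤ.+ t) (sym (eq i)) ⟩
    ℤ.- lin (A i) p ℤ.+ (x i ℤ.+ lin (A i) p) ≡⟨ cancel (lin (A i) p) (x i) ⟩
    x i ∎
    where
    open ≡-Reasoning
    cancel : ∀ p x → ℤ.- p ℤ.+ (x ℤ.+ p) ≡ x
    cancel = solve-∀

  difference? : ∀ x → Dec (Difference x)
  difference? x = map′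
    (λ (y , sol) → Vector.take n y , Vector.drop n y , sol⇒difference y sol)
    (λ (p , q , eq) → p Vector.++ q , difference⇒sol p q eq)
    (solvable? differenceSystem x)

  lattice⇒difference : ∀ {x} → Lattice A x → Difference x
  lattice⇒difference {x} (c , Ac≋x) = neg ∘ c , pos ∘ c , λ i → begin
    x i ℤ.+ lin (A i) (neg ∘ c)
      ≡⟨ cong (λ t → t ℤ.+ lin (A i) (neg ∘ c)) (sym (Ac≋x i)) ⟩
    ∑ℤ.sum (λ j → A i j ℤ.* c j) ℤ.+ ∑ℤ.sum (λ j → A i j ℤ.* + neg (c j))
      ≡⟨ sym (∑ℤ.∑-distrib-+ (λ j → A i j ℤ.* c j) (λ j → A i j ℤ.* + neg (c j))) ⟩
    ∑ℤ.sum (λ j → A i j ℤ.* c j ℤ.+ A i j ℤ.* + neg (c j))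
      ≡⟨ ∑ℤ.sum-cong-≗ (λ j → trans (sym (ℤ.*-distribˡ-+ (A i j) (c j) (+ neg (c j))))
                                     (cong (λ t → A i j ℤ.* t) (sym (pos≡+neg (c j))))) ⟩
    lin (A i) (pos ∘ c) ∎
    where open ≡-Reasoning

  difference⇒lattice : ∀ {x} → Difference x → Lattice A x
  difference⇒lattice {x} (p , q , eq) = (λ j → + q j ℤ.- + p j) , λ i → begin
    ∑ℤ.sum (λ j → A i j ℤ.* (+ q j ℤ.- + p j))
      ≡⟨ expand (A i) q p ⟩
    lin (A i) q ℤ.- lin (A i) p               ≡⟨ cong (λ t → t ℤ.- lin (A i) p) (sym (eq i)) ⟩
    x i ℤ.+ lin (A i) p ℤ.- lin (A i) p       ≡⟨ cancel (x i) (lin (A i) p) ⟩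
    x i ∎
    where
    open ≡-Reasoning
    cancel : ∀ x p → x ℤ.+ p ℤ.- p ≡ x
    cancel = solve-∀
    rearrange : ∀ a q p s t → a ℤ.* (q ℤ.- p) ℤ.+ (s ℤ.- t) ≡ (a ℤ.* q ℤ.+ s) ℤ.- (a ℤ.* p ℤ.+ t)
    rearrange = solve-∀
    expand : ∀ {m} (a : Vector ℤ m) q p →
      ∑ℤ.sum (λ j → a j ℤ.* (+ q j ℤ.- + p j)) ≡ lin a q ℤ.- lin a p
    expand {zero}  a q p = refl
    expand {suc m} a q p = trans
      (cong (λ t → head a ℤ.* (+ head q ℤ.- + head p) ℤ.+ t) (expand (tail a) (tail q) (tail p)))
      (rearrange (head a) (+ head q) (+ head p) (lin (tail a) (tail q)) (lin (tail a) (tail p)))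

  -- The approximations solve A l - N x = b with arbitrarily large N and b in a fixed
  -- box; if no period increased N, then N would be bounded by the starts over that box.
  cone⇒multiple : ∀ x → Cone A (Vector.map fromℤ x) → Multiple x
  cone⇒multiple x cone = case Any.any? (λ h → 0 ℕ.<? head h) periods of λ where
      (yes some) → let (h , h∈ , 0<h₀) = find some in from-period h 0<h₀ (periods-sol h∈)
      (no none)  → contradiction (too-large none) ℕ.1+n≰n
    where
    open Basis (basis (multipleSystem x))
    isolate : ∀ x k s → s ≡ (ℤ.- x ℤ.* k ℤ.+ s) ℤ.+ k ℤ.* x
    isolate = solve-∀
    from-period : ∀ h → 0 < head h → Sol (multipleSystem x) (λ _ → 0ℤ) h → Multiple x
    from-period h 0<h₀ sol with head h
    ... | suc k = k , tail h , λ i →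
      trans (isolate (x i) (+ suc k) (lin (A i) (tail h)))
        (trans (cong (λ t → t ℤ.+ + suc k ℤ.* x i) (sol i)) (ℤ.+-identityˡ _))
    C K : ℕ
    C = ∑ℕ.sum (λ i → suc (norm (A i)))
    heights-over : Vector ℤ d → List ℕ
    heights-over b = List.map head (starts b)
    heights : List ℕ
    heights = concatMap heights-over (intBox C d)
    K = max 0 heights
    too-large : ¬ Any.Any (λ h → 0 < head h) periods → suc K ≤ K
    too-large none =
      -- The multiplier is `suc K`, one more than the first coordinate of any start over the box.
      -- The residual `b` stays within `C` whatever the multiplier.
      let (l , close) = cone⇒approximation A x cone K
          b = λ i → lin (multipleSystem x i) (suc K Vector.∷ l)
          (b′ , b′∈ , b≗b′) = intBox-complete {C} b λ i → ℕ.≤-trans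
            (ℕ.≤-reflexive (trans (cong ∣_∣ (swap (x i) (+ suc K) (lin (A i) l)))
                                  (ℤ.∣-i∣≡∣i∣ (+ suc K ℤ.* x i ℤ.- lin (A i) l))))
            (ℕ.≤-trans (close i) (term≤sum (λ i → suc (norm (A i))) i))
          (g , g∈ , sucK≡) = generated⇒start-head
            (λ h∈ → ℕ.n≤0⇒n≡0 (ℕ.≮⇒≥ λ 0<h₀ → none (lose h∈ 0<h₀)))
            (generates {b′} {suc K Vector.∷ l} b≗b′)
      in ℕ.≤-trans (ℕ.≤-reflexive sucK≡)
           (∈⇒≤max (∈-concatMap⁺ heights-over (lose b′∈ (∈-map⁺ head g∈))))
      where
      swap : ∀ x k s → ℤ.- x ℤ.* k ℤ.+ s ≡ ℤ.- (k ℤ.* x ℤ.- s)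
      swap = solve-∀

  -- Saturation points modulo the columns

  infixl 6 _⊞_
  _⊞_ : Vector ℤ d → Vector ℕ n → Vector ℤ d
  (f ⊞ μ) i = f i ℤ.+ lin (A i) μ

  ⊞-⊕ : ∀ f μ ν → f ⊞ (μ ⊕ ν) ≗ f ⊞ μ ⊞ ν
  ⊞-⊕ f μ ν i = trans (cong (λ t → f i ℤ.+ t) (lin-⊕ (A i) μ ν)) (sym (ℤ.+-assoc (f i) _ _))

  multiple-⊞ : ∀ {f} μ → Multiple f → Multiple (f ⊞ μ)
  multiple-⊞ {f} μ (k , l , eq) = k , l ⊕ suc k • μ , λ i → begin
    lin (A i) (l ⊕ suc k • μ)                        ≡⟨ lin-⊕ (A i) l (suc k • μ) ⟩
    lin (A i) l ℤ.+ lin (A i) (suc k • μ)            ≡⟨ cong₂ ℤ._+_ (eq i) (lin-• (A i) (suc k) μ) ⟩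
    + suc k ℤ.* f i ℤ.+ + suc k ℤ.* lin (A i) μ      ≡⟨ sym (ℤ.*-distribˡ-+ (+ suc k) (f i) (lin (A i) μ)) ⟩
    + suc k ℤ.* (f ⊞ μ) i ∎
    where open ≡-Reasoning

  difference-⊞ : ∀ {f} μ → Difference f → Difference (f ⊞ μ)
  difference-⊞ {f} μ (p , q , eq) = p , q ⊕ μ , λ i → begin
    f i ℤ.+ lin (A i) μ ℤ.+ lin (A i) p    ≡⟨ swap (f i) (lin (A i) μ) (lin (A i) p) ⟩
    f i ℤ.+ lin (A i) p ℤ.+ lin (A i) μ    ≡⟨ cong (λ t → t ℤ.+ lin (A i) μ) (eq i) ⟩
    lin (A i) q ℤ.+ lin (A i) μ            ≡⟨ sym (lin-⊕ (A i) q μ) ⟩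
    lin (A i) (q ⊕ μ) ∎
    where
    open ≡-Reasoning
    swap : ∀ f m p → f ℤ.+ m ℤ.+ p ≡ f ℤ.+ p ℤ.+ m
    swap = solve-∀

  difference-⊞⁻ : ∀ {f x} μ → x ≗ f ⊞ μ → Difference x → Difference f
  difference-⊞⁻ {f} {x} μ x≗ (p , q , eq) = μ ⊕ p , q , λ i →
    trans (⊞-⊕ f μ p i) (trans (cong (λ t → t ℤ.+ lin (A i) p) (sym (x≗ i))) (eq i))

  semigroup-⊞ : ∀ {f} μ → Semigroup A f → Semigroup A (f ⊞ μ)
  semigroup-⊞ {f} μ (c , eq) = c ⊕ μ , λ i →
    trans (lin-⊕ (A i) c μ) (cong (λ t → t ℤ.+ lin (A i) μ) (eq i))

  multiple-resp : ∀ {x y} → x ≗ y → Multiple x → Multiple y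
  multiple-resp x≗y (k , l , eq) =
    k , l , λ i → trans (eq i) (cong (λ t → + suc k ℤ.* t) (x≗y i))

  difference-resp : ∀ {x y} → x ≗ y → Difference x → Difference y
  difference-resp x≗y (p , q , eq) =
    p , q , λ i → trans (cong (λ t → t ℤ.+ lin (A i) p) (sym (x≗y i))) (eq i)

  semigroup-resp : ∀ {x y} → x ≗ y → Semigroup A x → Semigroup A y
  semigroup-resp x≗y (c , eq) = c , λ i → trans (eq i) (x≗y i)

  -- Bounds the entries of all points `A ρ` of the zonotope.
  radius : ℕ
  radius = ∑ℕ.sum (λ i → norm (A i))

  -- Each `l j` is divided by `suc k`: the quotients form `μ`, and the remainders `ρ` satisfy
  -- `A ρ = (k + 1) f`. Hence `f` is the image of `ρ / (k + 1)` and lies in the zonotope.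
  reduce-mod-columns : ∀ x → Multiple x →
    ∃[ f ] ∃[ μ ] (f ∈ intBox radius d × Multiple f × x ≗ f ⊞ μ)
  reduce-mod-columns x (k , l , eq) =
    let (f′ , f′∈ , f≗f′) = intBox-complete {radius} f f≤radius
    in f′ , μ , f′∈ , multiple-resp f≗f′ (k , ρ , ρ-sol)
     , λ i → trans (restore (x i) (lin (A i) μ)) (cong (λ t → t ℤ.+ lin (A i) μ) (f≗f′ i))
    where
    μ ρ : Vector ℕ n
    μ j = l j ℕ./ suc k
    ρ j = l j ℕ.% suc k
    f : Vector ℤ d
    f i = x i ℤ.- lin (A i) μ
    restore : ∀ x m → x ≡ x ℤ.- m ℤ.+ m
    restore = solve-∀
    factor : ∀ k x m → k ℤ.* x ℤ.- k ℤ.* m ≡ k ℤ.* (x ℤ.- m)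
    factor = solve-∀
    cancel : ∀ p q → p ≡ p ℤ.+ q ℤ.- q
    cancel = solve-∀
    l≗ : l ≗ ρ ⊕ suc k • μ
    l≗ j = trans (ℕ.m≡m%n+[m/n]*n (l j) (suc k)) (cong (λ t → ρ j + t) (ℕ.*-comm (μ j) (suc k)))
    ρ-sol : ∀ i → lin (A i) ρ ≡ + suc k ℤ.* f i
    ρ-sol i = begin
      lin (A i) ρ                                        ≡⟨ cancel (lin (A i) ρ) (lin (A i) (suc k • μ)) ⟩
      lin (A i) ρ ℤ.+ lin (A i) (suc k • μ) ℤ.- lin (A i) (suc k • μ)
        ≡⟨ cong₂ ℤ._-_ (trans (sym (lin-⊕ (A i) ρ (suc k • μ))) (sym (lin-cong (A i) l≗)))
                       (lin-• (A i) (suc k) μ) ⟩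
      lin (A i) l ℤ.- + suc k ℤ.* lin (A i) μ            ≡⟨ cong (λ t → t ℤ.- + suc k ℤ.* lin (A i) μ) (eq i) ⟩
      + suc k ℤ.* x i ℤ.- + suc k ℤ.* lin (A i) μ        ≡⟨ factor (+ suc k) (x i) (lin (A i) μ) ⟩
      + suc k ℤ.* f i ∎
      where open ≡-Reasoning
    f≤radius : ∀ i → ∣ f i ∣ ≤ radius
    f≤radius i = ℕ.≤-trans (ℕ.*-cancelˡ-≤ (suc k) (begin
      suc k * ∣ f i ∣             ≡⟨ sym (ℤ.abs-* (+ suc k) (f i)) ⟩
      ∣ + suc k ℤ.* f i ∣         ≡⟨ cong ∣_∣ (sym (ρ-sol i)) ⟩
      ∣ lin (A i) ρ ∣             ≤⟨ ∣lin∣≤ (A i) ρ (λ j → ℕ.<⇒≤ (ℕ.m%n<n (l j) (suc k))) ⟩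
      norm (A i) * suc k          ≡⟨ ℕ.*-comm (norm (A i)) (suc k) ⟩
      suc k * norm (A i)          ∎)) (term≤sum (λ i → norm (A i)) i)
      where open ℕ.≤-Reasoning

  -- Decomposition into cells

  module Difference = Basis (basis differenceSystem)

  -- The generators of the ideal { λ | f + A λ ∈ Q } lie in [0, threshold f]ⁿ, so
  -- membership of λ only depends on its truncation at threshold f.
  threshold : Vector ℤ d → ℕ
  threshold f = max 0 (concatMap Vector.toList (Difference.starts f))

  -- A coordinate equal to `K` is one where truncation may have cut something off; the cell extends
  -- in exactly these directions.
  free : ℕ → Vector ℕ n → Fin n → Bool
  free K c j = does (c j ℕ.≟ K)

  restrict : ℕ → Vector ℕ n → Vector ℕ n → Vector ℕ n
  restrict K c ν j = if free K c j then ν j else 0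

  -- Columns of fixed coordinates are zeroed instead of deleted, so every cell has `n` generators; a
  -- zero generator adds nothing to the monoid.
  freeColumns : ℕ → Vector ℕ n → Matrix ℤ d n
  freeColumns K c i j = if free K c j then A i j else 0ℤ

  lin-freeColumns : ∀ K c ν i → lin (freeColumns K c i) ν ≡ lin (A i) (restrict K c ν)
  lin-freeColumns K c ν i = ∑ℤ.sum-cong-≗ λ j → entry (free K c j) (A i j) (ν j)
    where
    entry : ∀ b a m → (if b then a else 0ℤ) ℤ.* + m ≡ a ℤ.* + (if b then m else 0)
    entry true  a m = refl
    entry false a m = sym (ℤ.*-zeroʳ a)

  restrict-free : ∀ K c ν j → c j ≡ K → restrict K c ν j ≡ ν j
  restrict-free K c ν j cj≡K =
    cong (λ b → if b then ν j else 0) (dec-true (c j ℕ.≟ K) cj≡K)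

  restrict-fixed : ∀ K c ν j → c j ≢ K → restrict K c ν j ≡ 0
  restrict-fixed K c ν j cj≢K =
    cong (λ b → if b then ν j else 0) (dec-false (c j ℕ.≟ K) cj≢K)

  -- Where the minimum is below `K` nothing was cut off, so the excess of `μ` over `c` is supported
  -- on the free coordinates.
  truncation : ∀ K μ {c} → (λ j → μ j ⊓ K) ≗ c → μ ≗ c ⊕ restrict K c (λ j → μ j ∸ c j)
  truncation K μ {c} ⊓≗c j = sym (trans (cong (λ t → c j + t) rest) (ℕ.m+[n∸m]≡n c≤μ))
    where
    ν : Vector ℕ n
    ν j = μ j ∸ c j
    c≤μ : c j ≤ μ j
    c≤μ = ℕ.≤-trans (ℕ.≤-reflexive (sym (⊓≗c j))) (ℕ.m⊓n≤m (μ j) K)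
    rest : restrict K c ν j ≡ ν j
    rest with c j ℕ.≟ K | ℕ.≤-total (μ j) K
    ... | yes cj≡K | _ = restrict-free K c ν j cj≡K
    ... | no  cj≢K | inj₂ K≤μ = contradiction (trans (sym (⊓≗c j)) (ℕ.m≥n⇒m⊓n≡n K≤μ)) cj≢K
    ... | no  cj≢K | inj₁ μ≤K = trans (restrict-fixed K c ν j cj≢K)
      (sym (ℕ.m≤n⇒m∸n≡0 (ℕ.≤-reflexive (trans (sym (ℕ.m≤n⇒m⊓n≡m μ≤K)) (⊓≗c j)))))

  -- The solution `f + A κ = A τ` dominates a start `(p , q)`, whose entries are at most `K`. So
  -- `p ≤ c`: on free coordinates `c j = K`, on the others `κ j = c j`. Then
  -- `f + A c = A q + A (c - p)` lies in the semigroup.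
  semigroup-truncated : ∀ f c ν →
    Semigroup A (f ⊞ (c ⊕ restrict (threshold f) c ν)) → Semigroup A (f ⊞ c)
  semigroup-truncated f c ν (τ , eq) =
    let κ = c ⊕ restrict K c ν
        (g , g∈ , g≤) = generated⇒start≤
          (Difference.generates (difference⇒sol {f} κ τ (sym ∘ eq)))
        p = Vector.take n g
        q = Vector.drop n g
        p≤c = λ j → below (p j) j
          (∈⇒≤max (∈-concatMap⁺ Vector.toList (lose g∈ (∈-tabulate⁺ (j ↑ˡ n)))))
          (ℕ.≤-trans (g≤ (j ↑ˡ n)) (ℕ.≤-reflexive (lookup-++ˡ κ τ j)))
    in semigroup-resp {f ⊞ p ⊞ (λ j → c j ∸ p j)}
         (λ i → trans (sym (⊞-⊕ f p (λ j → c j ∸ p j) i))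
                      (cong (λ t → f i ℤ.+ t) (lin-cong (A i) (λ j → ℕ.m+[n∸m]≡n (p≤c j)))))
         (semigroup-⊞ (λ j → c j ∸ p j) (q , sym ∘ sol⇒difference g (Difference.starts-sol g∈)))
    where
    K : ℕ
    K = threshold f
    below : ∀ m j → m ≤ K → m ≤ c j + restrict K c ν j → m ≤ c j
    below m j m≤K m≤ with c j ℕ.≟ K
    ... | yes cj≡K = ℕ.≤-trans m≤K (ℕ.≤-reflexive (sym cj≡K))
    ... | no  cj≢K = ℕ.≤-trans m≤ (ℕ.≤-reflexive
      (trans (cong (λ t → c j + t) (restrict-fixed K c ν j cj≢K)) (ℕ.+-identityʳ (c j))))

  Cell : Set
  Cell = Vector ℤ d × Vector ℕ n

  -- A decidable form of the requirement that `f` is in the saturation and the corner `f + A c` is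
  -- outside the semigroup.
  HoleCell : Cell → Set
  HoleCell (f , c) = Multiple f × Difference f × ¬ Semigroup A (f ⊞ c)

  holeCell? : ∀ cell → Dec (HoleCell cell)
  holeCell? (f , c) = multiple? f ×-dec difference? f ×-dec ¬? (solvable? A (f ⊞ c))

  cellsOver : Vector ℤ d → List Cell
  cellsOver f = List.map (f ,_) (box (threshold f) n)

  allCells holeCells : List Cell
  allCells  = concatMap cellsOver (intBox radius d)
  holeCells = filter holeCell? allCells

  holeRepresentation : Representation d
  holeRepresentation = record
    { size  = List.length holeCells
    ; shift = λ k → let (f , c) = List.lookup holeCells k in f ⊞ c
    ; #gens = λ _ → n
    ; gens  = λ k → let (f , c) = List.lookup holeCells k in freeColumns (threshold f) c
    }

  InCell : Cell → Vector ℤ d → Set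
  InCell (f , c) = Translate (f ⊞ c) (Semigroup (freeColumns (threshold f) c))

  hole⇒cell : ∀ {x} → Holes A x → ∃[ cell ] (cell ∈ holeCells × InCell cell x)
  hole⇒cell {x} ((cone , lattice) , x∉Q) =
    let (f , μ , f∈ , f-mult , x≗) = reduce-mod-columns x (cone⇒multiple x cone)
        K = threshold f
        (c , c∈ , ⊓≗c) = box-complete {K} (λ j → μ j ⊓ K) (λ j → ℕ.m⊓n≤n (μ j) K)
        ν = λ j → μ j ∸ c j
        x≗′ = λ i → trans (x≗ i) (trans
          (cong (λ t → f i ℤ.+ t) (lin-cong (A i) (truncation K μ ⊓≗c)))
          (⊞-⊕ f c (restrict K c ν) i))
        -- `x` is the corner plus a natural combination of columns, so a corner in the semigroup
        -- would force `x` into it.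
        c∉Q = λ c∈Q → x∉Q (semigroup-resp (sym ∘ x≗′) (semigroup-⊞ (restrict K c ν) c∈Q))
    in (f , c)
     , ∈-filter⁺ holeCell?
         (∈-concatMap⁺ cellsOver (lose f∈ (∈-map⁺ (f ,_) c∈)))
         (f-mult , difference-⊞⁻ {f} μ x≗ (lattice⇒difference lattice) , c∉Q)
     , (λ i → lin (freeColumns K c i) ν) , (ν , λ _ → refl)
     , λ i → trans (cong (λ t → (f ⊞ c) i ℤ.+ t) (lin-freeColumns K c ν i)) (sym (x≗′ i))

  -- Adding columns to `f` stays in the cone and the lattice, while semigroup membership of `x`
  -- would descend to the corner by `semigroup-truncated`.
  cell⇒hole : ∀ {x} cell → HoleCell cell → InCell cell x → Holes A x
  cell⇒hole {x} (f , c) (f-mult , f-diff , c∉Q) (m , (ν , ν-eq) , x-eq) =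
    ( (let (k , l , eq) = multiple-resp κ≗x (multiple-⊞ κ f-mult) in multiple⇒cone A x k l eq)
    , difference⇒lattice (difference-resp κ≗x (difference-⊞ {f} κ f-diff)) )
    , λ x∈Q → c∉Q (semigroup-truncated f c ν (semigroup-resp (sym ∘ κ≗x) x∈Q))
    where
    κ : Vector ℕ n
    κ = c ⊕ restrict (threshold f) c ν
    κ≗x : f ⊞ κ ≗ x
    κ≗x i = trans (⊞-⊕ f c (restrict (threshold f) c ν) i)
      (trans (cong (λ t → (f ⊞ c) i ℤ.+ t)
                   (trans (sym (lin-freeColumns (threshold f) c ν i)) (ν-eq i)))
             (x-eq i))

theorem2p1 : Σ[ algorithm ∈ ((d n : ℕ) (A : Matrix ℤ d n) → Pointed A → Representation d) ]
    ((d n : ℕ) (A : Matrix ℤ d n) (pointed : Pointed A) →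
    Holes A ≐ ⟦ algorithm d n A pointed ⟧)
theorem2p1 = (λ d n A _ → holeRepresentation A) , λ d n A _ →
    (λ {x} hole → let (cell , cell∈ , x∈) = hole⇒cell A hole in
       index cell∈ , subst (λ cell → InCell A cell x) (Any.lookup-index cell∈) x∈)
  , λ {x} (k , x∈) → cell⇒hole A (List.lookup (holeCells A) k)
       (proj₂ (∈-filter⁻ (holeCell? A) {xs = allCells A} (∈-lookup k))) x∈
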